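{- There are absolute constants $\varepsilon,\delta>0$ such that, for $n$-node undirected unweighted graphs, any $+n^{\delta}$-additive $2$-FT preserver for a single pair $(s,t)$ needs $\Omega(n^{1+\varepsilon})$ edges in the worst case; i.e., there exist undirected unweighted $n$-node graphs $G$ and pairs $(s,t)$ for which every such preserver has $\Omega(n^{1+\varepsilon})$ edges.
   Context: A subgraph $H\subseteq G=(V,E)$ is a $+\beta$-additive $2$-FT preserver (spanner) for the pair $(s,t)$ if $\mathrm{dist}_{H\setminus F}(s,t)\leq \mathrm{dist}_{G\setminus F}(s,t)+\beta$ for every $F\subseteq E$ with $|F|\leq 2$. -}

module Defs where

open import Data.Nat using (ℕ; zero; suc; _+_; _≤_; _<ᵇ_)
open import Data.Bool using (Bool; true; false; _∧_; _∨_; not; if_then_else_)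
open import Data.Fin using (Fin; toℕ; _≟_)
open import Data.List using (List; []; _∷_; length; map; allFin; concatMap)
open import Data.Nat.ListAction using (sum)
open import Data.Bool.ListAction using (any)
open import Data.List.Relation.Unary.All using (All)
open import Data.Product using (_×_; _,_; Σ; ∃)
open import Relation.Binary.PropositionalEquality using (_≡_)
open import Relation.Nullary.Decidable using (⌊_⌋)

Adj : ℕ → Set
Adj n = Fin n → Fin n → Bool

record Graph (n : ℕ) : Set where
  field
    adj     : Adj n
    sym     : ∀ i j → adj i j ≡ adj j i
    irrefl  : ∀ i → adj i i ≡ false
open Graph public

_⊆G_ : ∀ {n} → Graph n → Graph n → Set
H ⊆G G = ∀ i j → adj H i j ≡ true → adj G i j ≡ true

edgeCount : ∀ {n} → Graph n → ℕ
edgeCount {n} G =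
  sum (concatMap (λ i → map (λ j → if (toℕ i <ᵇ toℕ j) ∧ adj G i j then 1 else 0)
                            (allFin n))
                 (allFin n))

hits : ∀ {n} → List (Fin n × Fin n) → Fin n → Fin n → Bool
hits F i j = any (λ { (u , v) → (⌊ u ≟ i ⌋ ∧ ⌊ v ≟ j ⌋) ∨ (⌊ u ≟ j ⌋ ∧ ⌊ v ≟ i ⌋) }) F

remove : ∀ {n} → Adj n → List (Fin n × Fin n) → Adj n
remove A F i j = A i j ∧ not (hits F i j)

data Walk {n : ℕ} (A : Adj n) : Fin n → Fin n → ℕ → Set where
  here : ∀ {s} → Walk A s s 0
  step : ∀ {s u t k} → A s u ≡ true → Walk A u t k → Walk A s t (suc k)

-- H is a +β-additive 2-FT preserver for (s,t) in G:
-- for every fault set F of at most two edges of G,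
-- dist_{H∖F}(s,t) ≤ dist_{G∖F}(s,t) + β  (with dist = ∞ if unreachable),
-- written out as: every s–t walk of length k in G∖F yields an s–t walk of
-- length ≤ k + β in H∖F.
FTPreserver2 : ∀ {n} → Graph n → Graph n → ℕ → Fin n → Fin n → Set
FTPreserver2 {n} G H β s t =
  (F : List (Fin n × Fin n)) → length F ≤ 2 →
  All (λ { (u , v) → adj G u v ≡ true }) F →
  ∀ k → Walk (remove (adj G) F) s t k →
  Σ ℕ (λ k′ → k′ ≤ k + β × Walk (remove (adj H) F) s t k′)

{-# OPTIONS --safe #-}

-- One fault on a path leaving s and one fault on a path entering t select a pair of terminals: from each
-- vertex of these paths hangs a chain to a terminal, and the chains get so much shorter along the path that
-- the last one before the fault is the cheapest exit.
--
-- The terminals are joined by a layered graph on grid points (X , Y). Each of its k layers adds a direction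
-- a to X and then a direction b to Y, along chains of length D + 2 m |a|² and D + 2 m |b|². By strict
-- convexity the shortest route from (k x , k y) to (k (x + a) , k (y + b)) repeats the directions a, b in all
-- layers, and every deviation costs at least 2 m. Between its two moves, a layer passes through a complete
-- bipartite graph of unit edges between all a and all b. The edge (a , b) at a given layer and grid point lies
-- on the route of one pair only, and without it the layer costs 2 more. Hence a preserver with additive error
-- below 2 m keeps more than k - m of the k private edges of every pair.
--
-- The hanging chains have to exceed the variation of the distances between grid points. To make this cheap,
-- the layered graph is taken in U² copies (u , v), where the terminals are (grid point , u) near s and
-- (grid point , v) near t: terminals at the same grid point have the same distances to all others, so the
-- variation matters only once in U terminals.

module Submission where

open import Defs renaming (sym to adj-sym)
open import Data.Nat using (ℕ; zero; suc; _+_; _*_; _^_; _∸_; _⊓_; _≤_; _<_; z≤n; s≤s; _<ᵇ_; _≤?_; NonZero; >-nonZero)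
open import Data.Nat.Properties
open import Data.Nat.Divisibility using (divides-refl)
open import Data.Nat.DivMod
  using (_/_; _%_; /-monoˡ-≤; m<n*o⇒m/o<n; m<n⇒m%n≡m; [m+kn]%n≡m%n; +-distrib-/-∣ʳ; m<n⇒m/n≡0; m*n/n≡m)
open import Data.Nat.ListAction using (sum)
open import Data.Nat.ListAction.Properties using (sum-++)
open import Data.Nat.Tactic.RingSolver using (solve-∀)
open import Data.Bool using (Bool; true; false; if_then_else_; _∧_; _∨_; not; T)
open import Data.Bool.Properties using (∨-comm; T-≡; T-∧; T-∨)
open import Data.Fin using (Fin; toℕ; fromℕ<) renaming (_≟_ to _≟F_)
open import Data.Fin.Properties using (toℕ-injective; toℕ-fromℕ<; any?)
open import Data.List using (List; []; _∷_; _++_; length; map; concatMap; upTo; cartesianProductWith; cartesianProduct; allFin; deduplicate)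
open import Data.List.Properties using (length-map; length-++; length-upTo; length-filter; map-++; map-∘; upTo-∷ʳ)
open import Data.List.Membership.Propositional using (_∈_)
open import Data.List.Membership.Propositional.Properties
open import Data.List.Relation.Unary.Any using (here; there)
open import Data.List.Relation.Unary.All as LAll using ([]; _∷_)
open import Data.List.Relation.Unary.AllPairs using ([]; _∷_)
open import Data.List.Relation.Unary.Unique.Propositional using (Unique)
import Data.List.Relation.Unary.Unique.Propositional.Properties as Uniq
open import Data.List.Relation.Unary.Unique.DecPropositional.Properties using (deduplicate-!)
open import Data.Vec using (Vec; []; _∷_; zipWith; replicate) renaming (map to vmap)
import Data.Vec.Properties as Vecₚ
open import Data.Vec.Relation.Unary.All as VAll using ([]; _∷_)
open import Data.Product using (Σ; _×_; _,_; proj₁; proj₂; uncurry; ∃)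
open import Data.Product.Properties using (≡-dec)
open import Data.Sum as Sum using (_⊎_; inj₁; inj₂; swap)
open import Function using (_∘_; Injective; Equivalence)
open import Relation.Binary.Definitions using (DecidableEquality; Decidable; tri<; tri≈; tri>)
open import Relation.Binary.PropositionalEquality
open import Relation.Nullary using (¬_; contradiction; yes; no; Dec)
open import Relation.Nullary.Decidable using (⌊_⌋; _×-dec_; map′; ¬?)

-- Lists, sums and linear inequalities

-- A certificate for linear inequalities: r + p ≡ l + q + s is left to the ring solver.
cancel-≤ : ∀ {p q l r} s → p ≤ q → r + p ≡ l + q + s → l ≤ r
cancel-≤ {p} {q} {l} {r} s p≤q eq = +-cancelʳ-≤ q l r (begin
  l + q      ≤⟨ m≤m+n (l + q) s ⟩
  l + q + s  ≡⟨ eq ⟨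
  r + p      ≤⟨ +-monoʳ-≤ r p≤q ⟩
  r + q      ∎)
  where open ≤-Reasoning

length-cartesianProductWith : ∀ {A B C : Set} (f : A → B → C) xs ys →
  length (cartesianProductWith f xs ys) ≡ length xs * length ys
length-cartesianProductWith f [] ys = refl
length-cartesianProductWith f (x ∷ xs) ys = trans
  (length-++ (map (f x) ys))
  (cong₂ _+_ (length-map (f x) ys) (length-cartesianProductWith f xs ys))

-- Past the end of the list the remaining index is handed to `junk`. A duplicate-free list and an
-- injective `junk` avoiding it therefore enumerate without repetition, which pads a vertex set to
-- any prescribed size.
nth : ∀ {A : Set} → (ℕ → A) → List A → ℕ → A
nth junk []       i       = junk i
nth junk (x ∷ xs) zero    = x
nth junk (x ∷ xs) (suc i) = nth junk xs i

∈⇒nth : ∀ {A : Set} (junk : ℕ → A) {x xs} → x ∈ xs → ∃ λ i → i < length xs × nth junk xs i ≡ x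
∈⇒nth junk (here refl) = zero , s≤s z≤n , refl
∈⇒nth junk (there x∈) with i , i< , eq ← ∈⇒nth junk x∈ = suc i , s≤s i< , eq

nth-∈ : ∀ {A : Set} (junk : ℕ → A) xs i → nth junk xs i ∈ xs ⊎ ∃ λ j → nth junk xs i ≡ junk j
nth-∈ junk []       i       = inj₂ (i , refl)
nth-∈ junk (x ∷ xs) zero    = inj₁ (here refl)
nth-∈ junk (x ∷ xs) (suc i) with nth-∈ junk xs i
... | inj₁ ∈xs = inj₁ (there ∈xs)
... | inj₂ eq  = inj₂ eq

nth-injective : ∀ {A : Set} (junk : ℕ → A) {xs} →
  (∀ {i j} → junk i ≡ junk j → i ≡ j) → (∀ {i} → ¬ junk i ∈ xs) → Unique xs →
  ∀ i j → nth junk xs i ≡ nth junk xs j → i ≡ j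
nth-injective junk inj ∉xs [] i j eq = inj eq
nth-injective junk inj ∉xs (x∉ ∷ u) zero zero eq = refl
nth-injective junk {x ∷ xs} inj ∉xs (x∉ ∷ u) zero (suc j) eq with nth-∈ junk xs j
... | inj₁ ∈xs = contradiction eq (LAll.lookup x∉ ∈xs)
... | inj₂ (_ , eq′) = contradiction (here (sym (trans eq eq′))) ∉xs
nth-injective junk {x ∷ xs} inj ∉xs (x∉ ∷ u) (suc i) zero eq with nth-∈ junk xs i
... | inj₁ ∈xs = contradiction (sym eq) (LAll.lookup x∉ ∈xs)
... | inj₂ (_ , eq′) = contradiction (here (trans (sym eq′) eq)) ∉xs
nth-injective junk inj ∉xs (x∉ ∷ u) (suc i) (suc j) eq =
  cong suc (nth-injective junk inj (∉xs ∘ there) u i j eq)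

-- Cutting one occurrence of `x` out of `ys` leaves a list that still contains the tail `xs`,
-- because `x` does not recur there.
sum-unique-≤ : ∀ {A : Set} (f : A → ℕ) {xs ys} → Unique xs → (∀ {x} → x ∈ xs → x ∈ ys) →
  sum (map f xs) ≤ sum (map f ys)
sum-unique-≤ f [] sub = z≤n
sum-unique-≤ f {x ∷ xs} {ys} (x∉ ∷ u) sub with ys₁ , ys₂ , refl ← ∈-∃++ (sub (here refl)) = begin
  f x + sum (map f xs)                        ≤⟨ +-monoʳ-≤ (f x) (sum-unique-≤ f u sub′) ⟩
  f x + sum (map f (ys₁ ++ ys₂))              ≡⟨ cong (λ l → f x + sum l) (map-++ f ys₁ ys₂) ⟩
  f x + sum (map f ys₁ ++ map f ys₂)          ≡⟨ cong (f x +_) (sum-++ (map f ys₁) _) ⟩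
  f x + (sum (map f ys₁) + sum (map f ys₂))   ≡⟨ exchange (f x) (sum (map f ys₁)) _ ⟩
  sum (map f ys₁) + (f x + sum (map f ys₂))   ≡⟨ sum-++ (map f ys₁) _ ⟨
  sum (map f ys₁ ++ map f (x ∷ ys₂))          ≡⟨ cong sum (map-++ f ys₁ (x ∷ ys₂)) ⟨
  sum (map f (ys₁ ++ x ∷ ys₂))                ∎
  where
  open ≤-Reasoning
  exchange : ∀ a b c → a + (b + c) ≡ b + (a + c)
  exchange = solve-∀
  sub′ : ∀ {y} → y ∈ xs → y ∈ ys₁ ++ ys₂
  sub′ {y} y∈ with ∈-++⁻ ys₁ (sub (there y∈))
  ... | inj₁ p         = ∈-++⁺ˡ p
  ... | inj₂ (there p) = ∈-++⁺ʳ ys₁ p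
  ... | inj₂ (here eq) = contradiction (sym eq) (LAll.lookup x∉ y∈)

map-unique-on : ∀ {A B : Set} (f : A → B) {xs} →
  (∀ {x y} → x ∈ xs → y ∈ xs → f x ≡ f y → x ≡ y) → Unique xs → Unique (map f xs)
map-unique-on f inj [] = []
map-unique-on f {x ∷ xs} inj (x∉ ∷ u) =
  LAll.tabulate (λ z∈ eq → case-map z∈ eq) ∷ map-unique-on f (λ p q → inj (there p) (there q)) u
  where
  case-map : ∀ {z} → z ∈ map f xs → ¬ f x ≡ z
  case-map z∈ eq with y , y∈ , refl ← ∈-map⁻ f z∈ = LAll.lookup x∉ y∈ (inj (here refl) (there y∈) eq)

sum-map-≥ : ∀ {A : Set} (f : A → ℕ) c xs → (∀ {x} → x ∈ xs → c ≤ f x) → length xs * c ≤ sum (map f xs)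
sum-map-≥ f c [] h = z≤n
sum-map-≥ f c (x ∷ xs) h = +-mono-≤ (h (here refl)) (sum-map-≥ f c xs (h ∘ there))

sum-cartesianProduct : ∀ {A B : Set} (f : A → B → ℕ) xs ys →
  sum (map (uncurry f) (cartesianProduct xs ys)) ≡ sum (map (λ x → sum (map (f x) ys)) xs)
sum-cartesianProduct f [] ys = refl
sum-cartesianProduct f (x ∷ xs) ys = begin
  sum (map (uncurry f) (map (x ,_) ys ++ cartesianProduct xs ys))
    ≡⟨ cong sum (map-++ (uncurry f) (map (x ,_) ys) _) ⟩
  sum (map (uncurry f) (map (x ,_) ys) ++ map (uncurry f) (cartesianProduct xs ys))
    ≡⟨ sum-++ (map (uncurry f) (map (x ,_) ys)) _ ⟩
  sum (map (uncurry f) (map (x ,_) ys)) + sum (map (uncurry f) (cartesianProduct xs ys))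
    ≡⟨ cong₂ (λ l s → sum l + s) (sym (map-∘ ys)) (sum-cartesianProduct f xs ys) ⟩
  sum (map (f x) ys) + sum (map (λ x → sum (map (f x) ys)) xs) ∎
  where open ≡-Reasoning

sum-concatMap : ∀ {A : Set} (f : A → List ℕ) xs → sum (concatMap f xs) ≡ sum (map (sum ∘ f) xs)
sum-concatMap f [] = refl
sum-concatMap f (x ∷ xs) = trans (sum-++ (f x) _) (cong (sum (f x) +_) (sum-concatMap f xs))

-- Integer vectors and strict convexity of the squared norm

_⊕_ : ∀ {d} → Vec ℕ d → Vec ℕ d → Vec ℕ d
_⊕_ = zipWith _+_
infixl 6 _⊕_

scale : ∀ {d} → ℕ → Vec ℕ d → Vec ℕ d
scale c = vmap (c *_)

dot : ∀ {d} → Vec ℕ d → Vec ℕ d → ℕ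
dot []      []      = 0
dot (a ∷ x) (b ∷ y) = a * b + dot x y

dot-⊕ : ∀ {d} (x y z : Vec ℕ d) → dot x (y ⊕ z) ≡ dot x y + dot x z
dot-⊕ [] [] [] = refl
dot-⊕ (a ∷ x) (b ∷ y) (c ∷ z) = trans (cong (a * (b + c) +_) (dot-⊕ x y z)) (lem a b c (dot x y) (dot x z))
  where
  lem : ∀ a b c s t → a * (b + c) + (s + t) ≡ a * b + s + (a * c + t)
  lem = solve-∀

dot-scale : ∀ {d} c (x y : Vec ℕ d) → dot x (scale c y) ≡ c * dot x y
dot-scale c [] [] = sym (*-zeroʳ c)
dot-scale c (a ∷ x) (b ∷ y) = trans (cong (a * (c * b) +_) (dot-scale c x y)) (lem a b c (dot x y))
  where
  lem : ∀ a b c s → a * (c * b) + c * s ≡ c * (a * b + s)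
  lem = solve-∀

-- The square of an integer is at least its absolute value. The latter is written
-- `(a ∸ b) + (b ∸ a)`, one of the two summands being zero.
square-gap : ∀ a b → 2 * (a * b) + (a ∸ b) + (b ∸ a) ≤ a * a + b * b
square-gap a b with ≤-total a b
... | inj₁ a≤b with c , refl ← m≤n⇒∃[o]m+o≡n a≤b =
  subst₂ (λ s t → 2 * (a * (a + c)) + s + t ≤ a * a + (a + c) * (a + c))
    (sym (m≤n⇒m∸n≡0 a≤b)) (sym (m+n∸m≡n a c)) (lem c)
  where
  eq₁ : ∀ a c → a * a + (a + suc c) * (a + suc c) ≡ 2 * (a * (a + suc c)) + 0 + suc c + c * suc c
  eq₁ = solve-∀
  lem : ∀ c → 2 * (a * (a + c)) + 0 + c ≤ a * a + (a + c) * (a + c)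
  lem zero = ≤-reflexive (eq₀ a)
    where
    eq₀ : ∀ a → 2 * (a * (a + 0)) + 0 + 0 ≡ a * a + (a + 0) * (a + 0)
    eq₀ = solve-∀
  lem (suc c) = ≤-trans (m≤m+n _ (c * suc c)) (≤-reflexive (sym (eq₁ a c)))
... | inj₂ b≤a with c , refl ← m≤n⇒∃[o]m+o≡n b≤a =
  subst₂ (λ s t → 2 * ((b + c) * b) + s + t ≤ (b + c) * (b + c) + b * b)
    (sym (m+n∸m≡n b c)) (sym (m≤n⇒m∸n≡0 b≤a)) (lem c)
  where
  eq₁ : ∀ b c → (b + suc c) * (b + suc c) + b * b ≡ 2 * ((b + suc c) * b) + suc c + 0 + c * suc c
  eq₁ = solve-∀
  lem : ∀ c → 2 * ((b + c) * b) + c + 0 ≤ (b + c) * (b + c) + b * b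
  lem zero = ≤-reflexive (eq₀ b)
    where
    eq₀ : ∀ b → 2 * ((b + 0) * b) + 0 + 0 ≡ (b + 0) * (b + 0) + b * b
    eq₀ = solve-∀
  lem (suc c) = ≤-trans (m≤m+n _ (c * suc c)) (≤-reflexive (sym (eq₁ b c)))

dot-amgm : ∀ {d} (x y : Vec ℕ d) → 2 * dot x y ≤ dot x x + dot y y
dot-amgm [] [] = z≤n
dot-amgm (a ∷ x) (b ∷ y) = cancel-≤ (a ∸ b + (b ∸ a)) (+-mono-≤ (square-gap a b) (dot-amgm x y))
  (lem (a * a) (b * b) (a * b) (a ∸ b) (b ∸ a) (dot x x) (dot y y) (dot x y))
  where
  lem : ∀ p q r s t u v w →
    p + u + (q + v) + (2 * r + s + t + 2 * w) ≡ 2 * (r + w) + (p + q + (u + v)) + (s + t)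
  lem = solve-∀

-- Distinct integer vectors differ by at least one in some coordinate, so their squared distance is
-- at least 1. Scaled by `2 * m`, this unit is the price of a wrong direction.
dot-amgm-strict : ∀ {d} (x y : Vec ℕ d) → x ≢ y → 2 * dot x y + 1 ≤ dot x x + dot y y
dot-amgm-strict [] [] x≢y = contradiction refl x≢y
dot-amgm-strict (a ∷ x) (b ∷ y) x≢y with a ≟ b
... | yes refl = cancel-≤ 0 (dot-amgm-strict x y (x≢y ∘ cong (a ∷_)))
  (lem (a * a) (dot x x) (dot y y) (dot x y))
  where
  lem : ∀ p u v w → p + u + (p + v) + (2 * w + 1) ≡ 2 * (p + w) + 1 + (u + v) + 0
  lem = solve-∀
... | no a≢b = cancel-≤ 0 (+-mono-≤ (≤-trans (+-monoʳ-≤ (2 * (a * b)) gap) (≤-trans (≤-reflexive (sym (+-assoc (2 * (a * b)) _ _))) (square-gap a b))) (dot-amgm x y))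
  (lem (a * a) (b * b) (a * b) (dot x x) (dot y y) (dot x y))
  where
  gap : 1 ≤ a ∸ b + (b ∸ a)
  gap with <-cmp a b
  ... | tri< a<b _ _ = ≤-trans (m<n⇒0<n∸m a<b) (m≤n+m _ (a ∸ b))
  ... | tri≈ _ a≡b _ = contradiction a≡b a≢b
  ... | tri> _ _ b<a = ≤-trans (m<n⇒0<n∸m b<a) (m≤m+n _ (b ∸ a))
  lem : ∀ p q r u v w → p + u + (q + v) + (2 * r + 1 + 2 * w) ≡ 2 * (r + w) + 1 + (p + q + (u + v)) + 0
  lem = solve-∀

Bounded : ∀ {d} → ℕ → Vec ℕ d → Set
Bounded r = VAll.All (_< r)

dot-bounded : ∀ {d p q} {x y : Vec ℕ d} → Bounded p x → Bounded q y → dot x y ≤ d * (p * q)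
dot-bounded [] [] = z≤n
dot-bounded (a< ∷ x<) (b< ∷ y<) = +-mono-≤ (*-mono-≤ (<⇒≤ a<) (<⇒≤ b<)) (dot-bounded x< y<)

vectors : ℕ → ∀ d → List (Vec ℕ d)
vectors r zero    = [] ∷ []
vectors r (suc d) = cartesianProductWith _∷_ (upTo r) (vectors r d)

length-vectors : ∀ r d → length (vectors r d) ≡ r ^ d
length-vectors r zero = refl
length-vectors r (suc d) = trans (length-cartesianProductWith _∷_ (upTo r) (vectors r d))
  (cong₂ _*_ (length-upTo r) (length-vectors r d))

vectors-unique : ∀ r d → Unique (vectors r d)
vectors-unique r zero = [] ∷ []
vectors-unique r (suc d) = Uniq.cartesianProductWith⁺ _∷_ Vecₚ.∷-injective (Uniq.upTo⁺ r) (vectors-unique r d)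

∈-vectors⁺ : ∀ {r d} {x : Vec ℕ d} → Bounded r x → x ∈ vectors r d
∈-vectors⁺ [] = here refl
∈-vectors⁺ (a< ∷ x<) = ∈-cartesianProductWith⁺ _∷_ (∈-upTo⁺ a<) (∈-vectors⁺ x<)

∈-vectors⁻ : ∀ {r d} {x : Vec ℕ d} → x ∈ vectors r d → Bounded r x
∈-vectors⁻ {d = zero} (here refl) = []
∈-vectors⁻ {r} {suc d} x∈
  with a , y , a∈ , y∈ , refl ← ∈-cartesianProductWith⁻ _∷_ (upTo r) (vectors r d) x∈ = ∈-upTo⁻ a∈ ∷ ∈-vectors⁻ y∈

bool→ℕ : Bool → ℕ
bool→ℕ b = if b then 1 else 0

-- Walks, faults and edge counts

-- Every lower bound on a distance comes from here: a potential rising by at most one per edge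
-- certifies it.
walk-length : ∀ {n} {A : Adj n} (φ : Fin n → ℕ) → (∀ i j → A i j ≡ true → φ j ≤ suc (φ i)) →
  ∀ {s t k} → Walk A s t k → φ t ≤ φ s + k
walk-length φ lip here = ≤-reflexive (sym (+-identityʳ _))
walk-length φ lip {s} {t} {suc k} (step {u = u} su w) = begin
  φ t           ≤⟨ walk-length φ lip w ⟩
  φ u + k       ≤⟨ +-monoˡ-≤ k (lip s u su) ⟩
  suc (φ s) + k ≡⟨ +-suc (φ s) k ⟨
  φ s + suc k   ∎
  where open ≤-Reasoning

SameEdge : ∀ {n} → Fin n × Fin n → Fin n → Fin n → Set
SameEdge (u , v) i j = (u ≡ i × v ≡ j) ⊎ (u ≡ j × v ≡ i)

T-⌊⌋ : ∀ {P : Set} (P? : Dec P) → T ⌊ P? ⌋ → P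
T-⌊⌋ (yes p) _ = p

⌊⌋-T : ∀ {P : Set} (P? : Dec P) → P → T ⌊ P? ⌋
⌊⌋-T (yes _) _ = _
⌊⌋-T (no ¬p) p = ¬p p

hits⁺ : ∀ {n} (F : List (Fin n × Fin n)) {i j e} → e ∈ F → SameEdge e i j → hits F i j ≡ true
hits⁺ (e ∷ F) {i} {j} e∈ same = Equivalence.to T-≡ (go e∈ same)
  where
  open Equivalence
  go : ∀ {e′} → e′ ∈ e ∷ F → SameEdge e′ i j → T (hits (e ∷ F) i j)
  go (here refl) (inj₁ (p , q)) =
    from T-∨ (inj₁ (from T-∨ (inj₁ (from T-∧ (⌊⌋-T (proj₁ e ≟F i) p , ⌊⌋-T (proj₂ e ≟F j) q)))))
  go (here refl) (inj₂ (p , q)) =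
    from T-∨ (inj₁ (from (T-∨ {⌊ proj₁ e ≟F i ⌋ ∧ ⌊ proj₂ e ≟F j ⌋}) (inj₂ (from T-∧ (⌊⌋-T (proj₁ e ≟F j) p , ⌊⌋-T (proj₂ e ≟F i) q)))))
  go (there e∈) s = from (T-∨ {(⌊ proj₁ e ≟F i ⌋ ∧ ⌊ proj₂ e ≟F j ⌋) ∨ (⌊ proj₁ e ≟F j ⌋ ∧ ⌊ proj₂ e ≟F i ⌋)})
    (inj₂ (from T-≡ (hits⁺ F e∈ s)))

hits⁻ : ∀ {n} (F : List (Fin n × Fin n)) {i j} → hits F i j ≡ true → ∃ λ e → e ∈ F × SameEdge e i j
hits⁻ (e ∷ F) {i} {j} h
  with Equivalence.to (T-∨ {(⌊ proj₁ e ≟F i ⌋ ∧ ⌊ proj₂ e ≟F j ⌋) ∨ (⌊ proj₁ e ≟F j ⌋ ∧ ⌊ proj₂ e ≟F i ⌋)}) (Equivalence.from T-≡ h)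
... | inj₂ h′ with e′ , e′∈ , s ← hits⁻ F (Equivalence.to T-≡ h′) = e′ , there e′∈ , s
... | inj₁ h′ with Equivalence.to (T-∨ {⌊ proj₁ e ≟F i ⌋ ∧ ⌊ proj₂ e ≟F j ⌋}) h′
...   | inj₁ h″ with p , q ← Equivalence.to (T-∧ {⌊ proj₁ e ≟F i ⌋}) h″ =
  e , here refl , inj₁ (T-⌊⌋ (proj₁ e ≟F i) p , T-⌊⌋ (proj₂ e ≟F j) q)
...   | inj₂ h″ with p , q ← Equivalence.to (T-∧ {⌊ proj₁ e ≟F j ⌋}) h″ =
  e , here refl , inj₂ (T-⌊⌋ (proj₁ e ≟F j) p , T-⌊⌋ (proj₂ e ≟F i) q)

remove⁺ : ∀ {n} (A : Adj n) F {i j} → A i j ≡ true → (∀ {e} → e ∈ F → ¬ SameEdge e i j) →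
  remove A F i j ≡ true
remove⁺ A F {i} {j} a safe with hits F i j in eq
... | true with e , e∈ , s ← hits⁻ F eq = contradiction s (safe e∈)
... | false rewrite a = refl

remove⁻ : ∀ {n} (A : Adj n) F {i j} → remove A F i j ≡ true →
  A i j ≡ true × (∀ {e} → e ∈ F → ¬ SameEdge e i j)
remove⁻ A F {i} {j} r with A i j | hits F i j in eq
... | true | false = refl , λ e∈ s → contradiction (trans (sym eq) (hits⁺ F e∈ s)) λ ()

-- `edgeCount` sees only pairs with the smaller index first, so each coded edge is sorted. Sorting
-- stays injective because no `α` end is ever a `β` end, which excludes the same edge with its ends
-- exchanged.
edgeCount-≥ : ∀ {n} (H : Graph n) {C : Set} (cs : List C) (α β : C → Fin n) → Unique cs →
  (∀ {c c′} → c ∈ cs → c′ ∈ cs → α c ≡ α c′ → β c ≡ β c′ → c ≡ c′) →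
  (∀ {c c′} → c ∈ cs → c′ ∈ cs → α c ≢ β c′) →
  sum (map (λ c → bool→ℕ (adj H (α c) (β c))) cs) ≤ edgeCount H
edgeCount-≥ {n} H {C} cs α β u inj α≢β = begin
  sum (map (λ c → bool→ℕ (adj H (α c) (β c))) cs)
    ≡⟨ cong sum (map-cong∈ cs (λ c∈ → weight-sorted _ _ (α≢β c∈ c∈))) ⟩
  sum (map (λ c → uncurry weight (sorted c)) cs)  ≡⟨ cong sum (map-∘ cs) ⟩
  sum (map (uncurry weight) (map sorted cs))
    ≤⟨ sum-unique-≤ (uncurry weight) (map-unique-on sorted sorted-inj u)
         (λ _ → ∈-cartesianProduct⁺ (∈-allFin _) (∈-allFin _)) ⟩
  sum (map (uncurry weight) (cartesianProduct (allFin n) (allFin n)))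
    ≡⟨ sum-cartesianProduct weight (allFin n) (allFin n) ⟩
  sum (map (λ i → sum (map (weight i) (allFin n))) (allFin n))
    ≡⟨ sum-concatMap (λ i → map (weight i) (allFin n)) (allFin n) ⟨
  edgeCount H ∎
  where
  open ≤-Reasoning
  weight : Fin n → Fin n → ℕ
  weight i j = if (toℕ i <ᵇ toℕ j) ∧ adj H i j then 1 else 0
  sort : Fin n → Fin n → Fin n × Fin n
  sort i j = if toℕ i <ᵇ toℕ j then (i , j) else (j , i)
  sorted : C → Fin n × Fin n
  sorted c = sort (α c) (β c)
  map-cong∈ : ∀ {f g : C → ℕ} xs → (∀ {x} → x ∈ xs → f x ≡ g x) → map f xs ≡ map g xs
  map-cong∈ [] eq = refl
  map-cong∈ (x ∷ xs) eq = cong₂ _∷_ (eq (here refl)) (map-cong∈ xs (eq ∘ there))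
  weight-sorted : ∀ i j → i ≢ j → bool→ℕ (adj H i j) ≡ uncurry weight (sort i j)
  weight-sorted i j i≢j with toℕ i <ᵇ toℕ j in eq
  ... | true rewrite eq = refl
  ... | false with <-cmp (toℕ i) (toℕ j)
  ...   | tri< i<j _ _ = contradiction (trans (sym eq) (Equivalence.to T-≡ (<⇒<ᵇ i<j))) λ ()
  ...   | tri≈ _ i≡j _ = contradiction (toℕ-injective i≡j) i≢j
  ...   | tri> _ _ j<i rewrite Equivalence.to T-≡ (<⇒<ᵇ j<i) | adj-sym H i j = refl
  sort-≡ : ∀ i j i′ j′ → sort i j ≡ sort i′ j′ → (i ≡ i′ × j ≡ j′) ⊎ i ≡ j′
  sort-≡ i j i′ j′ eq with toℕ i <ᵇ toℕ j | toℕ i′ <ᵇ toℕ j′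
  ... | true  | true  = inj₁ (cong proj₁ eq , cong proj₂ eq)
  ... | true  | false = inj₂ (cong proj₁ eq)
  ... | false | true  = inj₂ (cong proj₂ eq)
  ... | false | false = inj₁ (cong proj₂ eq , cong proj₁ eq)
  sorted-inj : ∀ {c c′} → c ∈ cs → c′ ∈ cs → sorted c ≡ sorted c′ → c ≡ c′
  sorted-inj {c} {c′} c∈ c′∈ eq with sort-≡ (α c) (β c) (α c′) (β c′) eq
  ... | inj₁ (p , q) = inj c∈ c′∈ p q
  ... | inj₂ p       = contradiction p (α≢β c∈ c′∈)

-- Walks over an arbitrary vertex type: routes are composed there and carried over to `Fin n` by
-- `trail⇒walk`.
data Trail {V : Set} (R : V → V → Set) : V → V → ℕ → Set where
  []  : ∀ {v} → Trail R v v 0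
  _∷_ : ∀ {u v w k} → R u v → Trail R v w k → Trail R u w (suc k)

module _ {V : Set} {R : V → V → Set} where

  _++ᵗ_ : ∀ {u v w k l} → Trail R u v k → Trail R v w l → Trail R u w (k + l)
  []      ++ᵗ q = q
  (r ∷ p) ++ᵗ q = r ∷ (p ++ᵗ q)

  infixr 5 _++ᵗ_

  reverseᵗ : (∀ {u v} → R u v → R v u) → ∀ {u v k} → Trail R u v k → Trail R v u k
  reverseᵗ R-sym [] = []
  reverseᵗ R-sym {k = suc k} (r ∷ p) =
    subst (Trail R _ _) (+-comm k 1) (reverseᵗ R-sym p ++ᵗ (R-sym r ∷ []))

  trail-via : (f : ℕ → V) → ∀ l → (∀ p → p < l → R (f p) (f (suc p))) → Trail R (f 0) (f l) l
  trail-via f zero    steps = []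
  trail-via f (suc l) steps = steps 0 (s≤s z≤n) ∷ trail-via (f ∘ suc) l (λ p p<l → steps (suc p) (s≤s p<l))

trail⇒walk : ∀ {n} {V : Set} (label : Fin n → V) {R : V → V → Set} (A : Adj n) →
  (∀ i w → R (label i) w → ∃ λ j → label j ≡ w × A i j ≡ true) →
  ∀ {v w k} → Trail R v w k → ∀ i → label i ≡ v → ∃ λ j → label j ≡ w × Walk A i j k
trail⇒walk label A lift [] i eq = i , eq , here
trail⇒walk label A lift (r ∷ p) i refl with j , refl , a ← lift i _ r
  with t , eq , w ← trail⇒walk label A lift p j refl = t , eq , step a w

module Labelled {n : ℕ} {V : Set} (_≟V_ : DecidableEquality V)
  (Edge : V → V → Set) (edge? : Decidable Edge) (loopless : ∀ v → ¬ Edge v v)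
  (label : Fin n → V) (label-injective : Injective _≡_ _≡_ label) where

  Linked : V → V → Set
  Linked v w = Edge v w ⊎ Edge w v

  abstract
    graph : Graph n
    graph = record
      { adj    = λ i j → ⌊ edge? (label i) (label j) ⌋ ∨ ⌊ edge? (label j) (label i) ⌋
      ; sym    = λ i j → ∨-comm ⌊ edge? (label i) (label j) ⌋ _
      ; irrefl = λ i → irr (edge? (label i) (label i)) (loopless (label i))
      }
      where
      irr : ∀ {P : Set} (P? : Dec P) → ¬ P → ⌊ P? ⌋ ∨ ⌊ P? ⌋ ≡ false
      irr (yes p) ¬p = contradiction p ¬p
      irr (no _)  ¬p = refl

    adj⁺ : ∀ i j → Linked (label i) (label j) → adj graph i j ≡ true
    adj⁺ i j (inj₁ e) = Equivalence.to T-≡ (Equivalence.from T-∨ (inj₁ (⌊⌋-T (edge? (label i) (label j)) e)))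
    adj⁺ i j (inj₂ e) = Equivalence.to T-≡
      (Equivalence.from (T-∨ {⌊ edge? (label i) (label j) ⌋}) (inj₂ (⌊⌋-T (edge? (label j) (label i)) e)))

    adj⁻ : ∀ i j → adj graph i j ≡ true → Linked (label i) (label j)
    adj⁻ i j a with Equivalence.to (T-∨ {⌊ edge? (label i) (label j) ⌋}) (Equivalence.from T-≡ a)
    ... | inj₁ t = inj₁ (T-⌊⌋ (edge? (label i) (label j)) t)
    ... | inj₂ t = inj₂ (T-⌊⌋ (edge? (label j) (label i)) t)

  find : Fin n → V → Fin n
  find default v with any? (λ i → label i ≟V v)
  ... | yes (i , _) = i
  ... | no _        = default

  label-find : ∀ default v → (∃ λ i → label i ≡ v) → label (find default v) ≡ v
  label-find default v ex with any? (λ i → label i ≟V v)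
  ... | yes (_ , eq) = eq
  ... | no ¬ex       = contradiction ex ¬ex

-- Subdivided graphs

module Subdivision {Hub Chain : Set} (_≟H_ : DecidableEquality Hub) (_≟C_ : DecidableEquality Chain)
  (Joined : Hub → Hub → Set) (joined? : Decidable Joined) (unjoined : ∀ a → ¬ Joined a a)
  (start end : Chain → Hub) (len : Chain → ℕ) where

  data Vertex : Set where
    hub   : Hub → Vertex
    inner : Chain → ℕ → Vertex

  -- The chain c runs through start c, inner c 0, …, inner c (len c ∸ 2), end c; the remaining inner c j
  -- form a pendant path, which is harmless.
  data Edge : Vertex → Vertex → Set where
    join  : ∀ {a b} → Joined a b → Edge (hub a) (hub b)
    first : ∀ {c} → Edge (hub (start c)) (inner c 0)
    next  : ∀ {c j} → Edge (inner c j) (inner c (suc j))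
    last  : ∀ {c j} → len c ≡ 2 + j → Edge (inner c j) (hub (end c))

  hub-injective : ∀ {a b} → hub a ≡ hub b → a ≡ b
  hub-injective refl = refl

  _≟V_ : DecidableEquality Vertex
  hub a     ≟V hub b     = map′ (cong hub) hub-injective (a ≟H b)
  hub a     ≟V inner c j = no λ ()
  inner c j ≟V hub a     = no λ ()
  inner c i ≟V inner d j with c ≟C d | i ≟ j
  ... | yes refl | yes refl = yes refl
  ... | no c≢d   | _        = no λ { refl → c≢d refl }
  ... | yes _    | no i≢j   = no λ { refl → i≢j refl }

  edge? : Decidable Edge
  edge? (hub a) (hub b) = map′ join (λ { (join ab) → ab }) (joined? a b)
  edge? (hub a) (inner c zero) = map′ (λ { refl → first }) (λ { first → refl }) (a ≟H start c)
  edge? (hub a) (inner c (suc j)) = no λ ()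
  edge? (inner c j) (hub a) with a ≟H end c | len c ≟ 2 + j
  ... | yes refl | yes l = yes (last l)
  ... | no a≢    | _     = no λ { (last _) → a≢ refl }
  ... | yes _    | no l≢ = no λ { (last l) → l≢ l }
  edge? (inner c i) (inner d j) with c ≟C d | j ≟ suc i
  ... | yes refl | yes refl = yes next
  ... | no c≢    | _        = no λ { next → c≢ refl }
  ... | yes _    | no j≢    = no λ { next → j≢ refl }

  loopless : ∀ v → ¬ Edge v v
  loopless (hub a) (join aa) = unjoined a aa
  loopless (inner c j) ()

  module Potential (φ : Hub → ℕ) (φ-up : ∀ c → φ (end c) ≤ φ (start c) + len c)
    (φ-down : ∀ c → φ (start c) ≤ φ (end c) + len c) where

    -- Inside a chain, the smaller of the two values obtained by climbing with slope one from either
    -- end. `φ-up` and `φ-down` make the climb from one end consistent with the value at the other.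
    Φ : Vertex → ℕ
    Φ (hub a)     = φ a
    Φ (inner c j) = (φ (start c) + suc j) ⊓ (φ (end c) + (len c ∸ suc j))

    -- The hypothesis on `φ` concerns only the given edge. It can thus be supplied under the
    -- knowledge that this edge is no fault and is present in the preserver.
    near : ∀ {v w} → Edge v w → (∀ {a b} → v ≡ hub a → w ≡ hub b → Joined a b → φ b ≤ suc (φ a) × φ a ≤ suc (φ b)) →
      Φ w ≤ suc (Φ v) × Φ v ≤ suc (Φ w)
    near (join ab) hubs = hubs refl refl ab
    near (first {c}) _ = ≤-trans (m⊓n≤m _ _) (≤-reflexive (+-comm (φ (start c)) 1))
      , ⊓-glb (≤-trans (m≤m+n (φ (start c)) 1) (n≤1+n _))
              (≤-trans (φ-down c) (≤-trans (+-monoʳ-≤ (φ (end c)) (m≤n+m∸n (len c) 1))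
                                           (≤-reflexive (+-suc (φ (end c)) _))))
    near (next {c} {j}) _ =
        ⊓-mono-≤ (≤-reflexive (+-suc (φ (start c)) (suc j)))
                 (m≤n⇒m≤1+n (+-monoʳ-≤ (φ (end c)) (∸-monoʳ-≤ (len c) (n≤1+n (suc j)))))
      , ⊓-mono-≤ (m≤n⇒m≤1+n (+-monoʳ-≤ (φ (start c)) (n≤1+n (suc j))))
                 (≤-trans (+-monoʳ-≤ (φ (end c)) (slow (len c) (suc j))) (≤-reflexive (+-suc (φ (end c)) _)))
      where
      slow : ∀ l j → l ∸ j ≤ suc (l ∸ suc j)
      slow zero j = subst (_≤ 1) (sym (0∸n≡0 j)) z≤n
      slow (suc l) zero = ≤-refl
      slow (suc l) (suc j) = slow l j
    near (last {c} {j} l) _ =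
        ⊓-glb (≤-trans (φ-up c) (≤-reflexive (trans (cong (φ (start c) +_) l) (+-suc (φ (start c)) (suc j)))))
              (m≤n⇒m≤1+n (m≤m+n (φ (end c)) _))
      , ≤-trans (m⊓n≤n (φ (start c) + suc j) _)
          (≤-reflexive (trans (cong (φ (end c) +_) (trans (cong (_∸ suc j) l) (m+n∸n≡m 1 j))) (+-comm (φ (end c)) 1)))

  module _ (R : Vertex → Vertex → Set) where

    chain-trail : ∀ c {l} → len c ≡ 2 + l →
      R (hub (start c)) (inner c 0) → (∀ j → j < l → R (inner c j) (inner c (suc j))) →
      R (inner c l) (hub (end c)) → Trail R (hub (start c)) (hub (end c)) (len c)
    chain-trail c {l} eq r₀ r rₗ = subst (Trail R _ _) (trans (cong suc (+-comm l 1)) (sym eq))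
      (r₀ ∷ (trail-via (inner c) l r ++ᵗ (rₗ ∷ [])))

-- The lower bound graph

data Side : Set where
  source target : Side

_≟S_ : DecidableEquality Side
source ≟S source = yes refl
source ≟S target = no λ ()
target ≟S source = no λ ()
target ≟S target = yes refl

-- (u , v , i , X , Y): copy (u , v), layer i, grid point (X , Y).
Place : ℕ → Set
Place d = ℕ × ℕ × ℕ × Vec ℕ d × Vec ℕ d

_≟P_ : ∀ {d} → DecidableEquality (Place d)
_≟P_ = ≡-dec _≟_ (≡-dec _≟_ (≡-dec _≟_ (≡-dec (Vecₚ.≡-dec _≟_) (Vecₚ.≡-dec _≟_))))

-- path s e is the e-th vertex of the path that may fail on side s, and the chain hang s e leads from it to
-- term s e. From node p, link source p a leads to the biclique at p shifted by a in X, whose sides are the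
-- mid source _ a and the mid target _ b; link target _ b leaves it with a shift by b in Y. The junk hubs are
-- isolated and serve to reach exactly n vertices.
data Hub (d : ℕ) : Set where
  junk : ℕ → Hub d
  path : Side → ℕ → Hub d
  term : Side → ℕ → Hub d
  node : Place d → Hub d
  mid  : Side → Place d → Vec ℕ d → Hub d

data Chain (d : ℕ) : Set where
  hang : Side → ℕ → Chain d
  link : Side → Place d → Vec ℕ d → Chain d

_≟H_ : ∀ {d} → DecidableEquality (Hub d)
junk i ≟H junk j = map′ (cong junk) (λ { refl → refl }) (i ≟ j)
path s e ≟H path t f = map′ (cong (uncurry path)) (λ { refl → refl }) (≡-dec _≟S_ _≟_ (s , e) (t , f))
term s e ≟H term t f = map′ (cong (uncurry term)) (λ { refl → refl }) (≡-dec _≟S_ _≟_ (s , e) (t , f))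
node p ≟H node q = map′ (cong node) (λ { refl → refl }) (p ≟P q)
mid s p a ≟H mid t q b = map′ (cong λ { (s , p , a) → mid s p a }) (λ { refl → refl })
  (≡-dec _≟S_ (≡-dec _≟P_ (Vecₚ.≡-dec _≟_)) (s , p , a) (t , q , b))
junk _    ≟H path _ _  = no λ ()
junk _    ≟H term _ _  = no λ ()
junk _    ≟H node _    = no λ ()
junk _    ≟H mid _ _ _ = no λ ()
path _ _  ≟H junk _    = no λ ()
path _ _  ≟H term _ _  = no λ ()
path _ _  ≟H node _    = no λ ()
path _ _  ≟H mid _ _ _ = no λ ()
term _ _  ≟H junk _    = no λ ()
term _ _  ≟H path _ _  = no λ ()
term _ _  ≟H node _    = no λ ()
term _ _  ≟H mid _ _ _ = no λ ()
node _    ≟H junk _    = no λ ()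
node _    ≟H path _ _  = no λ ()
node _    ≟H term _ _  = no λ ()
node _    ≟H mid _ _ _ = no λ ()
mid _ _ _ ≟H junk _    = no λ ()
mid _ _ _ ≟H path _ _  = no λ ()
mid _ _ _ ≟H term _ _  = no λ ()
mid _ _ _ ≟H node _    = no λ ()

_≟C_ : ∀ {d} → DecidableEquality (Chain d)
hang s e ≟C hang t f = map′ (cong (uncurry hang)) (λ { refl → refl }) (≡-dec _≟S_ _≟_ (s , e) (t , f))
hang _ _ ≟C link _ _ _ = no λ ()
link _ _ _ ≟C hang _ _ = no λ ()
link s p a ≟C link t q b = map′ (cong λ { (s , p , a) → link s p a }) (λ { refl → refl })
  (≡-dec _≟S_ (≡-dec _≟P_ (Vecₚ.≡-dec _≟_)) (s , p , a) (t , q , b))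

nth-bounded : ∀ {A : Set} {P : A → Set} {f : ℕ → A} {xs} →
  (∀ {x} → x ∈ xs → P x) → (∀ i → P (f i)) → ∀ i → P (nth f xs i)
nth-bounded {P = P} {f} {xs} all pf i with nth-∈ f xs i
... | inj₁ ∈xs      = all ∈xs
... | inj₂ (j , eq) = subst P (sym eq) (pf j)

-- A record in place of the bare equation lets list and length be read off the type without
-- unfolding `length`.
record HasLength {A : Set} (xs : List A) (n : ℕ) : Set where
  constructor exactly
  field proof : length xs ≡ n

hasLength-upTo : ∀ n → HasLength (upTo n) n
hasLength-upTo n = exactly (length-upTo n)

hasLength-vectors : ∀ r d → HasLength (vectors r d) (r ^ d)
hasLength-vectors r d = exactly (length-vectors r d)

hasLength-× : ∀ {A B : Set} {xs : List A} {ys : List B} {a b} →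
  HasLength xs a → HasLength ys b → HasLength (cartesianProduct xs ys) (a * b)
hasLength-× {xs = xs} {ys} (exactly refl) (exactly refl) = exactly (length-cartesianProductWith _,_ xs ys)

hasLength-map : ∀ {A B : Set} {f : A → B} {xs : List A} {a} → HasLength xs a → HasLength (map f xs) a
hasLength-map {f = f} {xs} (exactly refl) = exactly (length-map f xs)

hasLength-++ : ∀ {A : Set} {xs ys : List A} {a b} → HasLength xs a → HasLength ys b → HasLength (xs ++ ys) (a + b)
hasLength-++ {xs = xs} (exactly refl) (exactly refl) = exactly (length-++ xs)

module Construction (d k r U m D R : ℕ) {{_ : NonZero U}} where

  ports : List (Vec ℕ d × Vec ℕ d)
  ports = cartesianProduct (vectors (2 * r) d) (vectors (2 * r) d)

  K₀ K : ℕ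
  K₀ = length ports
  K  = K₀ * U

  slot : ℕ → ℕ
  slot e = e % U

  -- For `e < K` the quotient `e / U` indexes a genuine entry of `ports`. Coordinates run up to
  -- `2 * r` since the port near `t` is a sum of two vectors with entries below `r`.
  port : ℕ → Vec ℕ d × Vec ℕ d
  port e = nth (λ _ → replicate d 0 , replicate d 0) ports (e / U)

  gateX gateY : ℕ → Vec ℕ d
  gateX e = scale k (proj₁ (port e))
  gateY e = scale k (proj₂ (port e))

  -- Terminal e = ξ U + u is the u-th one at the ξ-th port. Leaving a path earlier than necessary costs at least
  -- 2 m + 1 more, and at least R more if the port changes, where R bounds how much distances vary with the port.
  hangLength : ℕ → ℕ
  hangLength e = (K₀ ∸ e / U) * R + (K ∸ e) * (2 * m + 1) + (R + 2 * m)

  linkLength : Vec ℕ d → ℕ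
  linkLength a = D + 2 * m * dot a a

  -- A source terminal opens into the copies `(slot e , v)` for all `v`, a target terminal is
  -- reached from `(u , slot e)` for all `u`. Two terminals thus have exactly one copy in common.
  data Joined : Hub d → Hub d → Set where
    along : ∀ s e → Joined (path s e) (path s (suc e))
    enter : ∀ e v → Joined (term source e) (node (slot e , v , 0 , gateX e , gateY e))
    cross : ∀ p a b → Joined (mid source p a) (mid target p b)
    leave : ∀ e u → Joined (node (u , slot e , k , gateX e , gateY e)) (term target e)

  joined? : Decidable Joined
  joined? (path s e) (path t f) = map′ (λ { (refl , refl) → along s e }) (λ { (along _ _) → refl , refl })
    ((s ≟S t) ×-dec (f ≟ suc e))
  joined? (term source e) (node (u , v , p)) =
    map′ (λ { refl → enter e v }) (λ { (enter _ _) → refl })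
      ((u , v , p) ≟P (slot e , v , 0 , gateX e , gateY e))
  joined? (node (u , v , p)) (term target e) =
    map′ (λ { refl → leave e u }) (λ { (leave _ _) → refl })
      ((u , v , p) ≟P (u , slot e , k , gateX e , gateY e))
  joined? (mid source p a) (mid target q b) = map′ (λ { refl → cross p a b }) (λ { (cross _ _ _) → refl }) (p ≟P q)
  joined? (junk _) _ = no λ ()
  joined? (path _ _) (junk _) = no λ ()
  joined? (path _ _) (term _ _) = no λ ()
  joined? (path _ _) (node _) = no λ ()
  joined? (path _ _) (mid _ _ _) = no λ ()
  joined? (term source _) (junk _) = no λ ()
  joined? (term source _) (path _ _) = no λ ()
  joined? (term source _) (term _ _) = no λ ()
  joined? (term source _) (mid _ _ _) = no λ ()
  joined? (term target _) _ = no λ ()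
  joined? (node _) (junk _) = no λ ()
  joined? (node _) (path _ _) = no λ ()
  joined? (node _) (term source _) = no λ ()
  joined? (node _) (node _) = no λ ()
  joined? (node _) (mid _ _ _) = no λ ()
  joined? (mid source _ _) (junk _) = no λ ()
  joined? (mid source _ _) (path _ _) = no λ ()
  joined? (mid source _ _) (term _ _) = no λ ()
  joined? (mid source _ _) (node _) = no λ ()
  joined? (mid source _ _) (mid source _ _) = no λ ()
  joined? (mid target _ _) _ = no λ ()

  unjoined : ∀ a → ¬ Joined a a
  unjoined (junk _) ()
  unjoined (path _ _) ()
  unjoined (term _ _) ()
  unjoined (node _) ()
  unjoined (mid _ _ _) ()

  start end : Chain d → Hub d
  start (hang s e) = path s e
  start (link source p a) = node p
  start (link target p b) = mid target p b
  end (hang s e) = term s e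
  end (link source (u , v , i , X , Y) a) = mid source (u , v , i , X ⊕ a , Y) a
  end (link target (u , v , i , X , Y) b) = node (u , v , suc i , X , Y ⊕ b)

  len : Chain d → ℕ
  len (hang s e)   = hangLength e
  len (link s p a) = linkLength a

  open Subdivision _≟H_ _≟C_ Joined joined? unjoined start end len public

  -- Uniform bounds on coordinates and chain lengths, so that the vertices form products. The
  -- surplus inner vertices of shorter chains lie on the pendant paths.
  Z Hmax Lmax : ℕ
  Z    = 2 * r * k
  Hmax = K₀ * R + K * (2 * m + 1) + (R + 2 * m)
  Lmax = D + 2 * m * (d * (r * r))

  sides : List Side
  sides = source ∷ target ∷ []

  ∈-sides : ∀ s → s ∈ sides
  ∈-sides source = here refl
  ∈-sides target = there (here refl)

  places : ℕ → List (Place d)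
  places l = cartesianProduct (upTo U) (cartesianProduct (upTo U) (cartesianProduct (upTo l)
    (cartesianProduct (vectors Z d) (vectors Z d))))

  links : List (Side × Place d × Vec ℕ d)
  links = cartesianProduct sides (cartesianProduct (places k) (vectors r d))

  pathVertices termVertices nodeVertices midVertices hangVertices linkVertices vertices : List Vertex
  pathVertices = map (λ (s , e) → hub (path s e)) (cartesianProduct sides (upTo (suc K)))
  termVertices = map (λ (s , e) → hub (term s e)) (cartesianProduct sides (upTo K))
  nodeVertices = map (λ p → hub (node p)) (places (suc k))
  midVertices  = map (λ (s , p , a) → hub (mid s p a)) links
  hangVertices = map (λ ((s , e) , j) → inner (hang s e) j) (cartesianProduct (cartesianProduct sides (upTo K)) (upTo Hmax))
  linkVertices = map (λ ((s , p , a) , j) → inner (link s p a) j) (cartesianProduct links (upTo Lmax))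
  vertices = pathVertices ++ termVertices ++ nodeVertices ++ midVertices ++ hangVertices ++ linkVertices

  InBox : ℕ → Place d → Set
  InBox l (u , v , i , X , Y) = u < U × v < U × i < l × Bounded Z X × Bounded Z Y

  ∈-places : ∀ {l p} → InBox l p → p ∈ places l
  ∈-places (u< , v< , i< , X< , Y<) = ∈-cartesianProduct⁺ (∈-upTo⁺ u<) (∈-cartesianProduct⁺ (∈-upTo⁺ v<)
    (∈-cartesianProduct⁺ (∈-upTo⁺ i<) (∈-cartesianProduct⁺ (∈-vectors⁺ X<) (∈-vectors⁺ Y<))))

  ∈-links : ∀ s {p a} → InBox k p → Bounded r a → (s , p , a) ∈ links
  ∈-links s p∈ a< = ∈-cartesianProduct⁺ (∈-sides s) (∈-cartesianProduct⁺ (∈-places p∈) (∈-vectors⁺ a<))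

  path∈ : ∀ s {e} → e ≤ K → hub (path s e) ∈ vertices
  path∈ s e≤ = ∈-++⁺ˡ (∈-map⁺ (λ (s , e) → hub (path s e)) (∈-cartesianProduct⁺ (∈-sides s) (∈-upTo⁺ (s≤s e≤))))

  term∈ : ∀ s {e} → e < K → hub (term s e) ∈ vertices
  term∈ s e< = ∈-++⁺ʳ pathVertices (∈-++⁺ˡ
    (∈-map⁺ (λ (s , e) → hub (term s e)) (∈-cartesianProduct⁺ (∈-sides s) (∈-upTo⁺ e<))))

  node∈ : ∀ {p} → InBox (suc k) p → hub (node p) ∈ vertices
  node∈ p∈ = ∈-++⁺ʳ pathVertices (∈-++⁺ʳ termVertices (∈-++⁺ˡ (∈-map⁺ (λ p → hub (node p)) (∈-places p∈))))

  mid∈ : ∀ s {p a} → InBox k p → Bounded r a → hub (mid s p a) ∈ vertices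
  mid∈ s p∈ a< = ∈-++⁺ʳ pathVertices (∈-++⁺ʳ termVertices (∈-++⁺ʳ nodeVertices (∈-++⁺ˡ
    (∈-map⁺ (λ (s , p , a) → hub (mid s p a)) (∈-links s p∈ a<)))))

  hang∈ : ∀ s {e j} → e < K → j < Hmax → inner (hang s e) j ∈ vertices
  hang∈ s e< j< = ∈-++⁺ʳ pathVertices (∈-++⁺ʳ termVertices (∈-++⁺ʳ nodeVertices (∈-++⁺ʳ midVertices (∈-++⁺ˡ
    (∈-map⁺ (λ ((s , e) , j) → inner (hang s e) j)
      (∈-cartesianProduct⁺ (∈-cartesianProduct⁺ (∈-sides s) (∈-upTo⁺ e<)) (∈-upTo⁺ j<)))))))

  link∈ : ∀ s {p a j} → InBox k p → Bounded r a → j < Lmax → inner (link s p a) j ∈ vertices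
  link∈ s p∈ a< j< = ∈-++⁺ʳ pathVertices (∈-++⁺ʳ termVertices (∈-++⁺ʳ nodeVertices (∈-++⁺ʳ midVertices (∈-++⁺ʳ hangVertices
    (∈-map⁺ (λ ((s , p , a) , j) → inner (link s p a) j) (∈-cartesianProduct⁺ (∈-links s p∈ a<) (∈-upTo⁺ j<)))))))

  junk∉ : ∀ {i} → ¬ hub (junk i) ∈ vertices
  junk∉ h with ∈-++⁻ pathVertices h
  ... | inj₁ h with _ , _ , () ← ∈-map⁻ (λ (s , e) → hub (path s e)) h
  ... | inj₂ h with ∈-++⁻ termVertices h
  ...   | inj₁ h with _ , _ , () ← ∈-map⁻ (λ (s , e) → hub (term s e)) h
  ...   | inj₂ h with ∈-++⁻ nodeVertices h
  ...     | inj₁ h with _ , _ , () ← ∈-map⁻ (λ p → hub (node p)) h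
  ...     | inj₂ h with ∈-++⁻ midVertices h
  ...       | inj₁ h with _ , _ , () ← ∈-map⁻ (λ (s , p , a) → hub (mid s p a)) h
  ...       | inj₂ h with ∈-++⁻ hangVertices h
  ...         | inj₁ h with _ , _ , () ← ∈-map⁻ (λ ((s , e) , j) → inner (hang s e) j) h
  ...         | inj₂ h with _ , _ , () ← ∈-map⁻ (λ ((s , p , a) , j) → inner (link s p a) j) h

  size : ℕ
  size = 2 * suc K + (2 * K + (U * (U * (suc k * (Z ^ d * Z ^ d)))
    + (2 * (U * (U * (k * (Z ^ d * Z ^ d))) * r ^ d)
    + (2 * K * Hmax + 2 * (U * (U * (k * (Z ^ d * Z ^ d))) * r ^ d) * Lmax))))

  hasLength-sides : HasLength sides 2
  hasLength-sides = exactly refl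

  length-places : ∀ l → HasLength (places l) (U * (U * (l * (Z ^ d * Z ^ d))))
  length-places l = hasLength-× (hasLength-upTo U) (hasLength-× (hasLength-upTo U) (hasLength-× (hasLength-upTo l)
    (hasLength-× (hasLength-vectors Z d) (hasLength-vectors Z d))))

  length-links : HasLength links (2 * (U * (U * (k * (Z ^ d * Z ^ d))) * r ^ d))
  length-links = hasLength-× hasLength-sides (hasLength-× (length-places k) (hasLength-vectors r d))

  length-vertices : HasLength vertices size
  length-vertices =
    hasLength-++ (hasLength-map (hasLength-× hasLength-sides (hasLength-upTo (suc K))))
    (hasLength-++ (hasLength-map (hasLength-× hasLength-sides (hasLength-upTo K)))
    (hasLength-++ (hasLength-map (length-places (suc k)))
    (hasLength-++ (hasLength-map length-links)
    (hasLength-++ (hasLength-map (hasLength-× (hasLength-× hasLength-sides (hasLength-upTo K)) (hasLength-upTo Hmax)))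
      (hasLength-map (hasLength-× length-links (hasLength-upTo Lmax)))))))

  K₀≡ : K₀ ≡ (2 * r) ^ d * (2 * r) ^ d
  K₀≡ = HasLength.proof (hasLength-× (hasLength-vectors (2 * r) d) (hasLength-vectors (2 * r) d))

-- Lattice lines

-- The grid point reached from `k x` after `i` equal steps. Scaling the ports by `k` makes the
-- average step between `k x` and `k (x + a)` the integer vector `a`.
line : ∀ {d} → ℕ → Vec ℕ d → Vec ℕ d → ℕ → Vec ℕ d
line k x a i = scale k x ⊕ scale i a

line-zero : ∀ {d} k (x a : Vec ℕ d) → line k x a 0 ≡ scale k x
line-zero k [] [] = refl
line-zero k (x ∷ xs) (a ∷ as) = cong₂ _∷_ (+-identityʳ (k * x)) (line-zero k xs as)

line-suc : ∀ {d} k (x a : Vec ℕ d) i → line k x a (suc i) ≡ line k x a i ⊕ a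
line-suc k [] [] i = refl
line-suc k (x ∷ xs) (a ∷ as) i = cong₂ _∷_ (lem k x a i) (line-suc k xs as i)
  where
  lem : ∀ k x a i → k * x + (a + i * a) ≡ k * x + i * a + a
  lem = solve-∀

line-end : ∀ {d} k (x a : Vec ℕ d) → line k x a k ≡ scale k (x ⊕ a)
line-end k [] [] = refl
line-end k (x ∷ xs) (a ∷ as) = cong₂ _∷_ (sym (*-distribˡ-+ k x a)) (line-end k xs as)

line-bound : ∀ {k r x a i} → 1 ≤ k → x < r → a < r → i ≤ k → k * x + i * a < 2 * r * k
line-bound {k} {r} {x} {a} {i} (s≤s {n = k′} z≤n) x<r a<r i≤k = begin-strict
  k * x + i * a   ≤⟨ +-monoʳ-≤ (k * x) (*-monoˡ-≤ a i≤k) ⟩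
  k * x + k * a   ≡⟨ *-distribˡ-+ k x a ⟨
  k * (x + a)     <⟨ *-monoʳ-< k (+-mono-<-≤ x<r (<⇒≤ a<r)) ⟩
  k * (r + r)     ≡⟨ lem k r ⟩
  2 * r * k       ∎
  where
  open ≤-Reasoning
  lem : ∀ k r → k * (r + r) ≡ 2 * r * k
  lem = solve-∀

line-bounded : ∀ {d k r i} {x a : Vec ℕ d} → 1 ≤ k → Bounded r x → Bounded r a → i ≤ k →
  Bounded (2 * r * k) (line k x a i)
line-bounded 1≤k [] [] i≤k = []
line-bounded 1≤k (x< ∷ xs<) (a< ∷ as<) i≤k = line-bound 1≤k x< a< i≤k ∷ line-bounded 1≤k xs< as< i≤k

scale-bounded : ∀ {d k r} {x : Vec ℕ d} → 1 ≤ k → Bounded r x → Bounded (r * k) (scale k x)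
scale-bounded 1≤k [] = []
scale-bounded {k = k} {r} (s≤s z≤n) (x< ∷ xs<) =
  <-≤-trans (*-monoʳ-< k x<) (≤-reflexive (*-comm k r)) ∷ scale-bounded (s≤s z≤n) xs<

⊕-bounded : ∀ {d r} {x y : Vec ℕ d} → Bounded r x → Bounded r y → Bounded (2 * r) (x ⊕ y)
⊕-bounded [] [] = []
⊕-bounded {r = r} (x< ∷ xs<) (y< ∷ ys<) =
  <-≤-trans (+-mono-<-≤ x< (<⇒≤ y<)) (≤-reflexive (cong (r +_) (sym (+-identityʳ r)))) ∷ ⊕-bounded xs< ys<

replicate-bounded : ∀ d {r} → 1 ≤ r → Bounded r (replicate d 0)
replicate-bounded zero 1≤r = []
replicate-bounded (suc d) 1≤r = 1≤r ∷ replicate-bounded d 1≤r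

-- Routes and potentials

-- `2m≤D` lets a link outweigh any bump, `square≤D` keeps the subtraction in `surplus` from
-- truncating, and `lam≤R` makes `R` a bound for the linear part of the potential on the whole grid.
module Demand (d k r U m D R : ℕ) {{nzU : NonZero U}}
  (1≤k : 1 ≤ k) (1≤r : 1 ≤ r) (1≤m : 1 ≤ m) (2m≤D : 2 * m ≤ D) (square≤D : 2 * m * (d * (r * r)) ≤ D)
  (lam≤R : 4 * m * (d * (r * (2 * r * k)) + d * (r * (2 * r * k))) ≤ R) where

  open Construction d k r U m D R

  port-bounded : ∀ e → Bounded (2 * r) (proj₁ (port e)) × Bounded (2 * r) (proj₂ (port e))
  port-bounded e = nth-bounded {P = λ p → Bounded (2 * r) (proj₁ p) × Bounded (2 * r) (proj₂ p)} {xs = ports}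
    (λ p∈ → let x∈ , y∈ = ∈-cartesianProduct⁻ (vectors (2 * r) d) (vectors (2 * r) d) p∈ in ∈-vectors⁻ x∈ , ∈-vectors⁻ y∈)
    (λ _ → zeros , zeros) (e / U)
    where
    zeros : Bounded (2 * r) (replicate d 0)
    zeros = replicate-bounded d (≤-trans 1≤r (m≤n*m r 2))

  gateX-bounded : ∀ e → Bounded Z (gateX e)
  gateX-bounded e = scale-bounded 1≤k (proj₁ (port-bounded e))

  gateY-bounded : ∀ e → Bounded Z (gateY e)
  gateY-bounded e = scale-bounded 1≤k (proj₂ (port-bounded e))

  -- The summand with factor `2 * m + 1` falls at every index, giving `2 * m` once and at least one
  -- per saved path edge. If the port changes, the block summand gives a further `R`, recorded in
  -- `slack`.
  hang-drop : ∀ {e e′} → e < e′ → e′ < K → ∃ λ slack →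
    hangLength e′ + 2 * m + (e′ ∸ e) + slack ≤ hangLength e × (e / U ≡ e′ / U ⊎ R ≤ slack)
  hang-drop {e} {e′} e<e′ e′<K = go (m≤n⇒m<n∨m≡n (/-monoˡ-≤ U (<⇒≤ e<e′)))
    where
    single : (K ∸ e′) * (2 * m + 1) + 2 * m + (e′ ∸ e) ≤ (K ∸ e) * (2 * m + 1)
    single with o , refl ← m≤n⇒∃[o]m+o≡n e<e′ = cancel-≤ (2 * m * o) (≤-reflexive split)
      (lem (K ∸ (suc e + o)) (2 * m) o _ (suc e + o ∸ e) (trans (cong (_∸ e) (sym (+-suc e o))) (m+n∸m≡n e (suc o))))
      where
      split : (K ∸ (suc e + o) + suc o) * (2 * m + 1) ≡ (K ∸ e) * (2 * m + 1)
      split = cong (_* (2 * m + 1)) (begin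
        K ∸ (suc e + o) + suc o ≡⟨ cong (λ z → K ∸ z + suc o) (+-suc e o) ⟨
        K ∸ (e + suc o) + suc o ≡⟨ cong (_+ suc o) (∸-+-assoc K e (suc o)) ⟨
        K ∸ e ∸ suc o + suc o   ≡⟨ m∸n+n≡m (m+n≤o⇒m≤o∸n (suc o) (≤-trans (≤-reflexive (trans (+-comm (suc o) e) (+-suc e o))) (<⇒≤ e′<K))) ⟩
        K ∸ e ∎)
        where open ≡-Reasoning
      lem : ∀ A t o Y w → w ≡ suc o → Y + (A + suc o) * (t + 1) ≡ A * (t + 1) + t + w + Y + t * o
      lem A t o Y w refl = lem′ A t o Y
        where
        lem′ : ∀ A t o Y → Y + (A + suc o) * (t + 1) ≡ A * (t + 1) + t + suc o + Y + t * o
        lem′ = solve-∀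
    combine : ∀ slack → (K₀ ∸ e′ / U) * R + slack ≤ (K₀ ∸ e / U) * R →
      hangLength e′ + 2 * m + (e′ ∸ e) + slack ≤ hangLength e
    combine slack block = cancel-≤ 0 (+-mono-≤ block single)
      (lem ((K₀ ∸ e / U) * R) ((K₀ ∸ e′ / U) * R) ((K ∸ e) * (2 * m + 1)) ((K ∸ e′) * (2 * m + 1)) (R + 2 * m) (2 * m) (e′ ∸ e) slack)
      where
      lem : ∀ p p′ q q′ c t w s → p + q + c + (p′ + s + (q′ + t + w)) ≡ p′ + q′ + c + t + w + s + (p + q) + 0
      lem = solve-∀
    go : e / U < e′ / U ⊎ e / U ≡ e′ / U → ∃ λ slack →
      hangLength e′ + 2 * m + (e′ ∸ e) + slack ≤ hangLength e × (e / U ≡ e′ / U ⊎ R ≤ slack)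
    go (inj₂ eq) = 0 , combine 0 (≤-reflexive (trans (+-identityʳ _) (cong (λ ξ → (K₀ ∸ ξ) * R) (sym eq)))) , inj₁ eq
    go (inj₁ lt) = R , combine R block , inj₂ ≤-refl
      where
      open ≤-Reasoning
      block : (K₀ ∸ e′ / U) * R + R ≤ (K₀ ∸ e / U) * R
      block = begin
        (K₀ ∸ e′ / U) * R + R   ≡⟨ +-comm _ R ⟩
        suc (K₀ ∸ e′ / U) * R   ≤⟨ *-monoˡ-≤ R (∸-monoʳ-< lt (<⇒≤ (m<n*o⇒m/o<n e′<K))) ⟩
        (K₀ ∸ e / U) * R        ∎

  -- The gradient of the link cost `2 * m * dot c c` at `a` is `4 * m` times `a`, and likewise at
  -- `b`; `lam` is the linear function of the position with these gradients.
  lam : Vec ℕ d → Vec ℕ d → Vec ℕ d → Vec ℕ d → ℕ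
  lam a b X Y = 4 * m * (dot a X + dot b Y)

  lam-bounded : ∀ {a b X Y} → Bounded r a → Bounded r b → Bounded Z X → Bounded Z Y → lam a b X Y ≤ R
  lam-bounded a< b< X< Y< = ≤-trans (*-monoʳ-≤ (4 * m) (+-mono-≤ (dot-bounded a< X<) (dot-bounded b< Y<))) lam≤R

  lam-⊕ˡ : ∀ a b X Y c → lam a b (X ⊕ c) Y ≡ lam a b X Y + 4 * m * dot a c
  lam-⊕ˡ a b X Y c = trans (cong (λ s → 4 * m * (s + dot b Y)) (dot-⊕ a X c)) (lem (4 * m) (dot a X) (dot a c) (dot b Y))
    where
    lem : ∀ t p q s → t * (p + q + s) ≡ t * (p + s) + t * q
    lem = solve-∀

  lam-⊕ʳ : ∀ a b X Y c → lam a b X (Y ⊕ c) ≡ lam a b X Y + 4 * m * dot b c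
  lam-⊕ʳ a b X Y c = trans (cong (λ s → 4 * m * (dot a X + s)) (dot-⊕ b Y c)) (lem (4 * m) (dot a X) (dot b Y) (dot b c))
    where
    lem : ∀ t p q s → t * (p + (q + s)) ≡ t * (p + q) + t * s
    lem = solve-∀

  -- The constant term of the tangent to the link cost at `c`: the tangent sends `z` to
  -- `surplus c + 4 * m * dot c z`.
  surplus : Vec ℕ d → ℕ
  surplus c = D ∸ 2 * m * dot c c

  surplus-+ : ∀ {c} → Bounded r c → D ≡ surplus c + 2 * m * dot c c
  surplus-+ {c} c< = sym (m∸n+n≡m (≤-trans (*-monoʳ-≤ (2 * m) (dot-bounded c< c<)) square≤D))

  -- Strict convexity: leaving the direction c★ costs at least 2 m, which pays for any change of the bonus.
  link-tight : ∀ {c★ bm bn} c → Bounded r c★ → bm ≤ 2 * m → (c ≡ c★ → bm ≤ bn) →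
    surplus c★ + 4 * m * dot c★ c + bm ≤ bn + linkLength c
  link-tight {c★} {bm} {bn} c c★< bm≤ bm≤bn with Vecₚ.≡-dec _≟_ c c★
  ... | yes refl = cancel-≤ 0 (bm≤bn refl) (trans
      (cong (λ z → bn + (z + 2 * m * dot c c) + bm) (surplus-+ c★<)) (lem (surplus c) m (dot c c) bm bn))
    where
    lem : ∀ κ m s bm bn → bn + (κ + 2 * m * s + 2 * m * s) + bm ≡ κ + 4 * m * s + bm + bn + 0
    lem = solve-∀
  ... | no c≢ = cancel-≤ bn (+-mono-≤ bm≤ (*-monoʳ-≤ (2 * m) (dot-amgm-strict c★ c (c≢ ∘ sym)))) (trans
      (cong (λ z → bn + (z + 2 * m * dot c c) + (bm + 2 * m * (2 * dot c★ c + 1))) (surplus-+ c★<))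
      (lem (surplus c★) m (dot c★ c★) (dot c c) (dot c★ c) bm bn))
    where
    lem : ∀ κ m q w p bm bn → bn + (κ + 2 * m * q + 2 * m * w) + (bm + 2 * m * (2 * p + 1))
      ≡ κ + 4 * m * p + bm + (2 * m + 2 * m * (q + w)) + bn
    lem = solve-∀

  choose : ∀ {P : Set} → Dec P → ℕ → ℕ → ℕ
  choose (yes _) s t = s
  choose (no _)  s t = t

  choose-≤ : ∀ {P : Set} (P? : Dec P) {s t w} → s ≤ w → t ≤ w → choose P? s t ≤ w
  choose-≤ (yes _) s≤ t≤ = s≤
  choose-≤ (no _)  s≤ t≤ = t≤

  R+2m≤hang : ∀ e → R + 2 * m ≤ hangLength e
  R+2m≤hang e = m≤n+m (R + 2 * m) ((K₀ ∸ e / U) * R + (K ∸ e) * (2 * m + 1))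

  R≤hang : ∀ e → R ≤ hangLength e
  R≤hang e = ≤-trans (m≤m+n R (2 * m)) (R+2m≤hang e)

  2≤2m : 2 ≤ 2 * m
  2≤2m = *-monoʳ-≤ 2 1≤m

  module Pair (u★ v★ : ℕ) (x y a b : Vec ℕ d) (eS eT : ℕ)
    (u< : u★ < U) (v< : v★ < U) (x< : Bounded r x) (y< : Bounded r y) (a< : Bounded r a) (b< : Bounded r b)
    (eS<K : eS < K) (eT<K : eT < K) (slot-S : slot eS ≡ u★) (slot-T : slot eT ≡ v★)
    (port-S : port eS ≡ (x , y)) (port-T : port eT ≡ (x ⊕ a , y ⊕ b)) where

    lineX lineY : ℕ → Vec ℕ d
    lineX = line k x a
    lineY = line k y b

    place : ℕ → Place d
    place i = u★ , v★ , i , lineX (suc i) , lineY i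

    tip : Side → ℕ
    tip source = eS
    tip target = eT

    Fault : Hub d → Hub d → Set
    Fault p q = ∃ λ s → p ≡ path s (tip s) × q ≡ path s (suc (tip s))

    gateLam : ℕ → ℕ
    gateLam e = lam a b (gateX e) (gateY e)

    tip<K : ∀ s → tip s < K
    tip<K source = eS<K
    tip<K target = eT<K

    Cut : Vertex → Vertex → Set
    Cut v w = ∃ λ s → v ≡ hub (path s (tip s)) × w ≡ hub (path s (suc (tip s)))

    Step : Vertex → Vertex → Set
    Step v w = (Edge v w ⊎ Edge w v) × v ∈ vertices × w ∈ vertices × ¬ Cut v w × ¬ Cut w v

    Step-sym : ∀ {v w} → Step v w → Step w v
    Step-sym (e , v∈ , w∈ , ¬vw , ¬wv) = swap e , w∈ , v∈ , ¬wv , ¬vw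

    path-trail : ∀ s → Trail Step (hub (path s 0)) (hub (path s (tip s))) (tip s)
    path-trail s = trail-via (λ e → hub (path s e)) (tip s) λ e e< →
        inj₁ (join (along s e))
      , path∈ s (≤-trans (<⇒≤ e<) (<⇒≤ (tip<K s)))
      , path∈ s (≤-trans e< (<⇒≤ (tip<K s)))
      , (λ { (_ , refl , _) → <-irrefl refl e< })
      , (λ { (_ , _ , refl) → <⇒≱ e< (n≤1+n _) })

    chain-route : ∀ c → 2 ≤ len c → hub (start c) ∈ vertices → hub (end c) ∈ vertices →
      (∀ j → 2 + j ≤ len c → inner c j ∈ vertices) → Trail Step (hub (start c)) (hub (end c)) (len c)
    chain-route c 2≤ start∈ end∈ inner∈ with l , eq ← m≤n⇒∃[o]m+o≡n 2≤ = chain-trail Step c (sym eq)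
      (inj₁ first , start∈ , inner∈ 0 2≤ , (λ { (_ , _ , ()) }) , (λ { (_ , () , _) }))
      (λ j j<l → inj₁ next , inner∈ j (inside (<⇒≤ j<l)) , inner∈ (suc j) (inside j<l)
        , (λ { (_ , () , _) }) , (λ { (_ , () , _) }))
      (inj₁ (last (sym eq)) , inner∈ l (inside ≤-refl) , end∈ , (λ { (_ , () , _) }) , (λ { (_ , _ , ()) }))
      where
      inside : ∀ {j} → j ≤ l → 2 + j ≤ len c
      inside j≤l = ≤-trans (s≤s (s≤s j≤l)) (≤-reflexive eq)

    hang-trail : ∀ s → Trail Step (hub (path s (tip s))) (hub (term s (tip s))) (hangLength (tip s))
    hang-trail s = chain-route (hang s (tip s)) (≤-trans 2≤2m (≤-trans (m≤n+m (2 * m) R) (R+2m≤hang (tip s))))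
      (path∈ s (<⇒≤ (tip<K s))) (term∈ s (tip<K s))
      (λ j j< → hang∈ s (tip<K s) (≤-trans (≤-trans (n≤1+n _) j<) (+-monoˡ-≤ (R + 2 * m)
        (+-mono-≤ (*-monoˡ-≤ R (m∸n≤m K₀ (tip s / U))) (*-monoˡ-≤ (2 * m + 1) (m∸n≤m K (tip s)))))))

    link-trail : ∀ s {p c} → InBox k p → Bounded r c → hub (start (link s p c)) ∈ vertices →
      hub (end (link s p c)) ∈ vertices → Trail Step (hub (start (link s p c))) (hub (end (link s p c))) (linkLength c)
    link-trail s {p} {c} p∈ c< start∈ end∈ = chain-route (link s p c) (≤-trans 2≤2m (≤-trans 2m≤D (m≤m+n D _))) start∈ end∈
      (λ j j< → link∈ s p∈ c< (≤-trans (≤-trans (n≤1+n _) j<) (+-monoʳ-≤ D (*-monoʳ-≤ (2 * m) (dot-bounded c< c<)))))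

    layerLength : ℕ
    layerLength = linkLength a + (1 + linkLength b)

    stop : ℕ → Place d
    stop i = u★ , v★ , i , lineX i , lineY i

    lineX-bounded : ∀ {i} → i ≤ k → Bounded Z (lineX i)
    lineX-bounded = line-bounded 1≤k x< a<

    lineY-bounded : ∀ {i} → i ≤ k → Bounded Z (lineY i)
    lineY-bounded = line-bounded 1≤k y< b<

    stop∈ : ∀ {i} → i ≤ k → hub (node (stop i)) ∈ vertices
    stop∈ i≤k = node∈ (u< , v< , s≤s i≤k , lineX-bounded i≤k , lineY-bounded i≤k)

    place-inBox : ∀ {i} → i < k → InBox k (place i)
    place-inBox i<k = u< , v< , i<k , lineX-bounded i<k , lineY-bounded (<⇒≤ i<k)

    mid-a∈ : ∀ {i} → i < k → hub (mid source (place i) a) ∈ vertices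
    mid-a∈ i<k = mid∈ source (place-inBox i<k) a<

    mid-b∈ : ∀ {i} → i < k → hub (mid target (place i) b) ∈ vertices
    mid-b∈ i<k = mid∈ target (place-inBox i<k) b<

    layer-trail : ∀ {i} → i < k → Trail Step (hub (node (stop i))) (hub (node (stop (suc i)))) layerLength
    layer-trail {i} i<k =
      subst (λ p → Trail Step (hub (node (stop i))) (hub p) (linkLength a)) arrive
        (link-trail source {stop i} {a} (u< , v< , i<k , lineX-bounded (<⇒≤ i<k) , lineY-bounded (<⇒≤ i<k)) a<
          (stop∈ (<⇒≤ i<k)) (subst (λ p → hub p ∈ vertices) (sym arrive) (mid-a∈ i<k)))
      ++ᵗ ((inj₁ (join (cross (place i) a b)) , mid-a∈ i<k , mid-b∈ i<k , (λ { (_ , () , _) }) , (λ { (_ , () , _) }))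
      ∷ subst (λ p → Trail Step (hub (mid target (place i) b)) (hub p) (linkLength b)) depart
          (link-trail target {place i} {b} (place-inBox i<k) b< (mid-b∈ i<k)
            (subst (λ p → hub p ∈ vertices) (sym depart) (stop∈ i<k))))
      where
      arrive : end (link source (stop i) a) ≡ mid source (place i) a
      arrive = cong (λ X → mid source (u★ , v★ , i , X , lineY i) a) (sym (line-suc k x a i))
      depart : end (link target (place i) b) ≡ node (stop (suc i))
      depart = cong (λ Y → node (u★ , v★ , suc i , lineX (suc i) , Y)) (sym (line-suc k y b i))

    layers-trail : ∀ i → i ≤ k → Trail Step (hub (node (stop 0))) (hub (node (stop i))) (i * layerLength)
    layers-trail zero    _   = []
    layers-trail (suc i) i<k = subst (Trail Step _ _) (+-comm (i * layerLength) layerLength)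
      (layers-trail i (<⇒≤ i<k) ++ᵗ layer-trail i<k)

    gate-S : (slot eS , v★ , 0 , gateX eS , gateY eS) ≡ stop 0
    gate-S = cong₂ (λ u p → u , v★ , 0 , p) slot-S (cong₂ _,_
      (trans (cong (scale k ∘ proj₁) port-S) (sym (line-zero k x a)))
      (trans (cong (scale k ∘ proj₂) port-S) (sym (line-zero k y b))))

    gate-T : (u★ , slot eT , k , gateX eT , gateY eT) ≡ stop k
    gate-T = cong₂ (λ v p → u★ , v , k , p) slot-T (cong₂ _,_
      (trans (cong (scale k ∘ proj₁) port-T) (sym (line-end k x a)))
      (trans (cong (scale k ∘ proj₂) port-T) (sym (line-end k y b))))

    enter-step : Step (hub (term source eS)) (hub (node (stop 0)))
    enter-step = inj₁ (join (subst (λ p → Joined (term source eS) (node p)) gate-S (enter eS v★)))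
      , term∈ source eS<K , stop∈ z≤n , (λ { (_ , () , _) }) , (λ { (_ , () , _) })

    leave-step : Step (hub (node (stop k))) (hub (term target eT))
    leave-step = inj₁ (join (subst (λ p → Joined (node p) (term target eT)) gate-T (leave eT u★)))
      , stop∈ ≤-refl , term∈ target eT<K , (λ { (_ , () , _) }) , (λ { (_ , () , _) })

    routeLength : ℕ
    routeLength = eS + (hangLength eS + (1 + (k * layerLength + (1 + (hangLength eT + eT)))))

    route : Trail Step (hub (path source 0)) (hub (path target 0)) routeLength
    route = path-trail source ++ᵗ hang-trail source ++ᵗ (enter-step ∷ (layers-trail k ≤-refl
      ++ᵗ (leave-step ∷ (reverseᵗ Step-sym (hang-trail target) ++ᵗ reverseᵗ Step-sym (path-trail target)))))

    dot-gate-T : ∀ (c z w : Vec ℕ d) → dot c (scale k (z ⊕ w)) ≡ dot c (scale k z) + k * dot c w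
    dot-gate-T c z w = begin
      dot c (scale k (z ⊕ w))         ≡⟨ dot-scale k c (z ⊕ w) ⟩
      k * dot c (z ⊕ w)               ≡⟨ cong (k *_) (dot-⊕ c z w) ⟩
      k * (dot c z + dot c w)         ≡⟨ *-distribˡ-+ k (dot c z) (dot c w) ⟩
      k * dot c z + k * dot c w       ≡⟨ cong (_+ k * dot c w) (dot-scale k c z) ⟨
      dot c (scale k z) + k * dot c w ∎
      where open ≡-Reasoning

    gateLam-T : gateLam eT ≡ gateLam eS + k * (4 * m * (dot a a + dot b b))
    gateLam-T = begin
      lam a b (gateX eT) (gateY eT)
        ≡⟨ cong (λ p → lam a b (scale k (proj₁ p)) (scale k (proj₂ p))) port-T ⟩
      4 * m * (dot a (scale k (x ⊕ a)) + dot b (scale k (y ⊕ b)))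
        ≡⟨ cong₂ (λ s t → 4 * m * (s + t)) (dot-gate-T a x a) (dot-gate-T b y b) ⟩
      4 * m * (dot a (scale k x) + k * dot a a + (dot b (scale k y) + k * dot b b))
        ≡⟨ lem (4 * m) k (dot a (scale k x)) (dot b (scale k y)) (dot a a) (dot b b) ⟩
      lam a b (scale k x) (scale k y) + k * (4 * m * (dot a a + dot b b))
        ≡⟨ cong (λ p → lam a b (scale k (proj₁ p)) (scale k (proj₂ p)) + k * (4 * m * (dot a a + dot b b))) port-S ⟨
      gateLam eS + k * (4 * m * (dot a a + dot b b)) ∎
      where
      open ≡-Reasoning
      lem : ∀ t k p q s w → t * (p + k * s + (q + k * w)) ≡ t * (p + q) + k * (t * (s + w))
      lem = solve-∀

    -- `bonus i` stands for the extra length forced by missing private edges before layer `i`. A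
    -- layer adds at most 2, the cost of a detour inside its biclique; the cap `2 * m` is the cost
    -- of abandoning the route, and the last layer is assumed to reach it.
    module Lower (bonus : ℕ → ℕ) (bonus-zero : bonus 0 ≡ 0) (bonus-up : ∀ i → bonus i ≤ bonus (suc i))
      (bonus-step : ∀ i → bonus (suc i) ≤ 2 + bonus i) (bonus-bounded : ∀ i → bonus i ≤ 2 * m)
      (bonus-full : bonus k ≡ 2 * m) where

      On : ℕ → Vec ℕ d → Vec ℕ d → ℕ → ℕ → Set
      On u X Y i j = (u , X , Y) ≡ (u★ , lineX i , lineY j)

      on? : ∀ u X Y i j → Dec (On u X Y i j)
      on? u X Y i j = ≡-dec _≟_ (≡-dec (Vecₚ.≡-dec _≟_) (Vecₚ.≡-dec _≟_)) (u , X , Y) (u★ , lineX i , lineY j)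

      _≟V★_ : (c c★ : Vec ℕ d) → Dec (c ≡ c★)
      _≟V★_ = Vecₚ.≡-dec _≟_

      -- In the copies with `v ≡ v★`, a vertex off the route gets the full `2 * m`, paid by a wrong
      -- exit or a wrong direction. In other copies the value is 0, because there the `2 * m` falls
      -- due on the hanging chain near `t`.
      bump : ℕ → ∀ {P : Set} → Dec P → ℕ → ℕ
      bump v on? t = choose (v ≟ v★) (choose on? t (2 * m)) 0

      bump-≤ : ∀ v {P : Set} (P? : Dec P) {t} → t ≤ 2 * m → bump v P? t ≤ 2 * m
      bump-≤ v P? t≤ = choose-≤ (v ≟ v★) (choose-≤ P? t≤ ≤-refl) z≤n

      nodeBump : ℕ → ℕ → ℕ → Vec ℕ d → Vec ℕ d → ℕ
      nodeBump u v i X Y = bump v (on? u X Y i i) (bonus i)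

      -- A missing private edge at layer i forces the detour mid source a – mid target b′ –
      -- mid source a′ – mid target b, whose four vertices get bonus i, bonus i, bonus (suc i), bonus (suc i).
      midBump : Side → Place d → Vec ℕ d → ℕ
      midBump source (u , v , i , X , Y) c = bump v (on? u X Y (suc i) i) (choose (c ≟V★ a) (bonus i) (bonus (suc i)))
      midBump target (u , v , i , X , Y) c = bump v (on? u X Y (suc i) i) (choose (c ≟V★ b) (bonus (suc i)) (bonus i))

      nodeBump-≤ : ∀ u v i X Y → nodeBump u v i X Y ≤ 2 * m
      nodeBump-≤ u v i X Y = bump-≤ v (on? u X Y i i) (bonus-bounded i)

      midBump-≤ : ∀ s p c → midBump s p c ≤ 2 * m
      midBump-≤ source (u , v , i , X , Y) c = bump-≤ v (on? u X Y (suc i) i)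
        (choose-≤ (c ≟V★ a) (bonus-bounded i) (bonus-bounded (suc i)))
      midBump-≤ target (u , v , i , X , Y) c = bump-≤ v (on? u X Y (suc i) i)
        (choose-≤ (c ≟V★ b) (bonus-bounded (suc i)) (bonus-bounded i))

      targetBump : ℕ → ℕ
      targetBump e = choose (slot e ≟ v★) (2 * m) 0

      -- A source terminal sees all copies (slot e , v), so at layer 0 every copy is given the bumps of copy v★.
      tag : ℕ → ℕ → ℕ
      tag v zero    = v★
      tag v (suc i) = v

      gateLam-≤ : ∀ e → gateLam e ≤ R
      gateLam-≤ e = lam-bounded a< b< (gateX-bounded e) (gateY-bounded e)

      -- Terminals with the same quotient by `U` share their gate; otherwise `slack` covers the
      -- entire range of `gateLam`.
      gateLam-close : ∀ {e e′ slack} → e / U ≡ e′ / U ⊎ R ≤ slack → gateLam e ≤ gateLam e′ + slack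
      gateLam-close {e} {e′} {slack} (inj₁ eq) = ≤-trans
        (≤-reflexive (cong (λ ξ → let p = nth (λ _ → replicate d 0 , replicate d 0) ports ξ in
          lam a b (scale k (proj₁ p)) (scale k (proj₂ p))) eq)) (m≤m+n (gateLam e′) slack)
      gateLam-close {e} {e′} (inj₂ R≤) = ≤-trans (gateLam-≤ e) (≤-trans R≤ (m≤n+m _ (gateLam e′)))

      κa κb κ A B : ℕ
      κa = surplus a
      κb = surplus b
      κ  = κa + 1 + κb
      A  = eS + hangLength eS
      B  = A + 2 + k * κ

      -- φ replaces the convex link cost by the linear function lam supporting it at (a , b); the bumps add the
      -- detours forced by missing private edges.
      φ : Hub d → ℕ
      φ (junk _)        = 0
      φ (path source e) = choose (e ≤? eS) (gateLam eS + e) A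
      φ (path target e) = choose (e ≤? eT) (B + gateLam eT + 2 * m + hangLength eT + (eT ∸ e)) B
      φ (term source e) = A + gateLam e + nodeBump (slot e) v★ 0 (gateX e) (gateY e)
      φ (term target e) = B + gateLam e + targetBump e
      φ (node (u , v , i , X , Y)) = A + 1 + i * κ + lam a b X Y + nodeBump u (tag v i) i X Y
      φ (mid source (u , v , i , X , Y) c) = A + 1 + i * κ + κa + lam a b X Y + midBump source (u , v , i , X , Y) c
      φ (mid target (u , v , i , X , Y) c) = A + 2 + i * κ + κa + lam a b X Y + midBump target (u , v , i , X , Y) c

      nodeBump-start : nodeBump (slot eS) v★ 0 (gateX eS) (gateY eS) ≡ 0
      nodeBump-start with v★ ≟ v★ | on? (slot eS) (gateX eS) (gateY eS) 0 0
      ... | no ≢  | _      = contradiction refl ≢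
      ... | yes _ | yes _  = bonus-zero
      ... | yes _ | no off = contradiction (cong₂ _,_ slot-S (cong₂ _,_
        (trans (cong (scale k ∘ proj₁) port-S) (sym (line-zero k x a)))
        (trans (cong (scale k ∘ proj₂) port-S) (sym (line-zero k y b))))) off

      targetBump-tip : targetBump eT ≡ 2 * m
      targetBump-tip with slot eT ≟ v★
      ... | yes _ = refl
      ... | no ≢  = contradiction slot-T ≢

      -- In a layer after the first, `tag` keeps the copy. With the bonus at its cap, positions on
      -- and off the route no longer differ, which matches the terminals near `t`.
      leave-bump : ∀ {i} u e X Y → 1 ≤ i → bonus i ≡ 2 * m → nodeBump u (tag (slot e) i) i X Y ≡ targetBump e
      leave-bump {suc i} u e X Y _ full with slot e ≟ v★ | on? u X Y (suc i) (suc i)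
      ... | no _  | _     = refl
      ... | yes _ | yes _ = full
      ... | yes _ | no _  = refl

      suc⇒near : ∀ {s t} → t ≡ suc s → t ≤ suc s × s ≤ suc t
      suc⇒near refl = ≤-refl , m≤n⇒m≤1+n (n≤1+n _)

      joined-near : ∀ {p q} → Joined p q → ¬ Fault p q →
        (∀ i → p ≡ mid source (place i) a → q ≡ mid target (place i) b → bonus (suc i) ≤ bonus i) →
        φ q ≤ suc (φ p) × φ p ≤ suc (φ q)
      joined-near (along source e) ¬fault _ with e ≤? eS | suc e ≤? eS
      ... | yes _  | yes _  = suc⇒near (+-suc (gateLam eS) e)
      -- The potential of the path breaks its unit slope only between the tip and its successor, and
      -- this edge is the fault.
      ... | yes e≤ | no se≰ = contradiction (source , cong (path source) e≡ , cong (path source ∘ suc) e≡) ¬fault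
        where
        e≡ : e ≡ eS
        e≡ = ≤-antisym e≤ (≮⇒≥ se≰)
      ... | no e≰  | yes se≤ = contradiction (<⇒≤ se≤) e≰
      ... | no _   | no _    = n≤1+n _ , n≤1+n _
      joined-near (along target e) ¬fault _ with e ≤? eT | suc e ≤? eT
      ... | yes _  | yes se≤ = let near = suc⇒near (trans (cong (c +_) (+-∸-assoc 1 se≤)) (+-suc c (eT ∸ suc e))) in proj₂ near , proj₁ near
        where
        c : ℕ
        c = B + gateLam eT + 2 * m + hangLength eT
      ... | yes e≤ | no se≰ = contradiction (target , cong (path target) e≡ , cong (path target ∘ suc) e≡) ¬fault
        where
        e≡ : e ≡ eT
        e≡ = ≤-antisym e≤ (≮⇒≥ se≰)
      ... | no e≰  | yes se≤ = contradiction (<⇒≤ se≤) e≰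
      ... | no _   | no _    = n≤1+n _ , n≤1+n _
      joined-near (enter e v) _ _ = suc⇒near (lem A (gateLam e) (nodeBump (slot e) v★ 0 (gateX e) (gateY e)))
        where
        lem : ∀ A l n → A + 1 + 0 + l + n ≡ suc (A + l + n)
        lem = solve-∀
      joined-near (leave e u) _ _ = suc⇒near (begin
        A + 2 + k * κ + gateLam e + targetBump e
          ≡⟨ cong (A + 2 + k * κ + gateLam e +_) (leave-bump u e (gateX e) (gateY e) 1≤k bonus-full) ⟨
        A + 2 + k * κ + gateLam e + nodeBump u (tag (slot e) k) k (gateX e) (gateY e)
          ≡⟨ lem A (k * κ) (gateLam e) _ ⟩
        suc (A + 1 + k * κ + gateLam e + nodeBump u (tag (slot e) k) k (gateX e) (gateY e)) ∎)
        where
        open ≡-Reasoning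
        lem : ∀ A s l n → A + 2 + s + l + n ≡ suc (A + 1 + s + l + n)
        lem = solve-∀
      joined-near (cross (u , v , i , X , Y) c c′) _ kept =
          cancel-≤ 0 (proj₁ bumps) (up A (i * κ) κa (lam a b X Y) (midBump source p c) (midBump target p c′))
        , cancel-≤ 0 (proj₂ bumps) (down A (i * κ) κa (lam a b X Y) (midBump source p c) (midBump target p c′))
        where
        p : Place d
        p = u , v , i , X , Y
        up : ∀ A s κ l ms mt → suc (A + 1 + s + κ + l + ms) + mt ≡ A + 2 + s + κ + l + mt + ms + 0
        up = solve-∀
        down : ∀ A s κ l ms mt → suc (A + 2 + s + κ + l + mt) + ms ≡ A + 1 + s + κ + l + ms + (2 + mt) + 0
        down = solve-∀
        -- Without bumps the target side is higher by one, which leaves these two conditions on the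
        -- bumps. On the route only the private edge `(a , b)` goes from `bonus i` to
        -- `bonus (suc i)`, so it alone needs `kept`; the edge avoiding both `a` and `b` uses
        -- `bonus-step`.
        bumps : midBump target p c′ ≤ midBump source p c × midBump source p c ≤ 2 + midBump target p c′
        bumps with v ≟ v★ | on? u X Y (suc i) i
        ... | no _  | _    = z≤n , z≤n
        ... | yes _ | no _ = ≤-refl , m≤n+m _ 2
        ... | yes refl | yes refl with c ≟V★ a | c′ ≟V★ b
        ...   | yes refl | yes refl = kept i refl refl , ≤-trans (bonus-up i) (m≤n+m _ 2)
        ...   | yes _    | no _     = ≤-refl , m≤n+m _ 2
        ...   | no _     | yes _    = ≤-refl , m≤n+m _ 2
        ...   | no _     | no _     = bonus-up i , bonus-step i

      -- On the route both ends carry `bonus i`, and a node off the route in a copy with `v ≡ v★`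
      -- already has the maximum. Directions other than `a` are left to `link-tight`.
      mid-entered : ∀ u v i X Y → midBump source (u , v , i , X ⊕ a , Y) a ≤ nodeBump u (tag v i) i X Y
      mid-entered u v i X Y with v ≟ v★
      ... | no _ = z≤n
      ... | yes refl = ≤-trans (onLine (on? u X Y i i)) (≤-reflexive (tagged i))
        where
        tagged : ∀ i → choose (on? u X Y i i) (bonus i) (2 * m) ≡ nodeBump u (tag v★ i) i X Y
        tagged zero with v★ ≟ v★
        ... | yes _ = refl
        ... | no ≢  = contradiction refl ≢
        tagged (suc i) with v★ ≟ v★
        ... | yes _ = refl
        ... | no ≢  = contradiction refl ≢
        onLine : (on : Dec (On u X Y i i)) →
          choose (on? u (X ⊕ a) Y (suc i) i) (choose (a ≟V★ a) (bonus i) (bonus (suc i))) (2 * m) ≤ choose on (bonus i) (2 * m)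
        onLine (no _) = choose-≤ (on? u (X ⊕ a) Y (suc i) i)
          (choose-≤ (a ≟V★ a) (bonus-bounded i) (bonus-bounded (suc i))) ≤-refl
        onLine (yes refl) with on? u (lineX i ⊕ a) Y (suc i) i | a ≟V★ a
        ... | yes _ | yes _ = ≤-refl
        ... | yes _ | no ≢  = contradiction refl ≢
        ... | no ≢  | _     = contradiction (cong (λ z → u , z , Y) (sym (line-suc k x a i))) ≢

      mid-left : ∀ u v i X Y → nodeBump u v (suc i) X (Y ⊕ b) ≤ midBump target (u , v , i , X , Y) b
      mid-left u v i X Y with v ≟ v★
      ... | no _ = z≤n
      ... | yes _ with on? u X Y (suc i) i
      ...   | no _ = choose-≤ (on? u X (Y ⊕ b) (suc i) (suc i)) (bonus-bounded (suc i)) ≤-refl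
      ...   | yes refl with on? u X (Y ⊕ b) (suc i) (suc i) | b ≟V★ b
      ...     | yes _ | yes _ = ≤-refl
      ...     | yes _ | no ≢  = contradiction refl ≢
      ...     | no ≢  | _     = contradiction (cong (λ z → u , X , z) (sym (line-suc k y b i))) ≢

      φ-up : ∀ c → φ (end c) ≤ φ (start c) + len c
      φ-up (hang source e) with e ≤? eS
      -- Beyond the fault the path has the constant potential `A`. The part `R + 2 * m` of every
      -- hanging length covers whatever the terminal adds to it.
      ... | no _ = cancel-≤ 0 (+-mono-≤ (gateLam-≤ e) (≤-trans (+-monoʳ-≤ R (nodeBump-≤ (slot e) v★ 0 (gateX e) (gateY e))) (R+2m≤hang e)))
        (lem A (hangLength e) (gateLam e) R (nodeBump (slot e) v★ 0 (gateX e) (gateY e)))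
        where
        lem : ∀ A h l R n → A + h + (l + (R + n)) ≡ A + l + n + (R + h) + 0
        lem = solve-∀
      ... | yes e≤ with m≤n⇒m<n∨m≡n e≤
      ...   | inj₂ refl = ≤-reflexive (trans (cong (A + gateLam e +_) nodeBump-start) (lem eS (hangLength eS) (gateLam eS)))
        where
        lem : ∀ e h l → e + h + l + 0 ≡ l + e + h
        lem = solve-∀
      -- The three gains of the longer chain are spent as follows: `2 * m` on the bump, `eS ∸ e` on
      -- the path edges saved, and `slack` on the difference of the gates.
      ...   | inj₁ e< with slack , drop , close ← hang-drop e< eS<K =
        cancel-≤ 0 (+-mono-≤ drop (+-mono-≤ (gateLam-close close) (nodeBump-≤ (slot e) v★ 0 (gateX e) (gateY e))))
          (subst (λ z → gateLam eS + e + hangLength e + (hangLength eS + 2 * m + (eS ∸ e) + slack + (gateLam e + bp))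
               ≡ z + hangLength eS + gateLam e + bp + (hangLength e + (gateLam eS + slack + 2 * m)) + 0)
            (m+[n∸m]≡n e≤)
            (lem e (eS ∸ e) (hangLength eS) (hangLength e) (gateLam eS) (gateLam e) slack (2 * m) bp))
        where
        bp : ℕ
        bp = nodeBump (slot e) v★ 0 (gateX e) (gateY e)
        lem : ∀ e t h he g l s w n → g + e + he + (h + w + t + s + (l + n)) ≡ e + t + h + l + n + (he + (g + s + w)) + 0
        lem = solve-∀
      φ-up (hang target e) = ≤-trans (+-monoʳ-≤ (B + gateLam e) (choose-≤ (slot e ≟ v★) ≤-refl z≤n)) (begin
        B + gateLam e + 2 * m ≤⟨ cancel-≤ 0 (+-mono-≤ (gateLam-≤ e) (R+2m≤hang e)) (lem B (hangLength e) (gateLam e) R (2 * m)) ⟩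
        B + hangLength e      ≤⟨ +-monoˡ-≤ (hangLength e) (B≤ (e ≤? eT)) ⟩
        φ (path target e) + hangLength e ∎)
        where
        open ≤-Reasoning
        lem : ∀ A h l R n → A + h + (l + (R + n)) ≡ A + l + n + (R + h) + 0
        lem = solve-∀
        B≤ : (P? : Dec (e ≤ eT)) → B ≤ choose P? (B + gateLam eT + 2 * m + hangLength eT + (eT ∸ e)) B
        B≤ (no _)  = ≤-refl
        B≤ (yes _) = ≤-trans (m≤m+n B _) (≤-reflexive (lem′ B (gateLam eT) (2 * m) (hangLength eT) (eT ∸ e)))
          where
          lem′ : ∀ B g w h t → B + (g + w + h + t) ≡ B + g + w + h + t
          lem′ = solve-∀
      φ-up (link source (u , v , i , X , Y) c) = cancel-≤ 0 (link-tight c a< (midBump-≤ source (u , v , i , X ⊕ c , Y) c) same)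
        (trans (lem A (i * κ) κa (4 * m * dot a c) (lam a b X Y) (midBump source (u , v , i , X ⊕ c , Y) c) (linkLength c) (nodeBump u (tag v i) i X Y))
          (cong (λ z → A + 1 + i * κ + κa + z + midBump source (u , v , i , X ⊕ c , Y) c + (nodeBump u (tag v i) i X Y + linkLength c) + 0)
            (sym (lam-⊕ˡ a b X Y c))))
        where
        same : c ≡ a → midBump source (u , v , i , X ⊕ c , Y) c ≤ nodeBump u (tag v i) i X Y
        same refl = mid-entered u v i X Y
        lem : ∀ A s κa p l bm L bn → A + 1 + s + l + bn + L + (κa + p + bm) ≡ A + 1 + s + κa + (l + p) + bm + (bn + L) + 0
        lem = solve-∀
      φ-up (link target (u , v , i , X , Y) c) = cancel-≤ 0 (link-tight c b< (nodeBump-≤ u v (suc i) X (Y ⊕ c)) same)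
        (trans (lem A i κa κb (4 * m * dot b c) (lam a b X Y) (nodeBump u v (suc i) X (Y ⊕ c)) (linkLength c) (midBump target (u , v , i , X , Y) c))
          (cong (λ z → A + 1 + suc i * κ + z + nodeBump u v (suc i) X (Y ⊕ c) + (midBump target (u , v , i , X , Y) c + linkLength c) + 0)
            (sym (lam-⊕ʳ a b X Y c))))
        where
        same : c ≡ b → nodeBump u v (suc i) X (Y ⊕ c) ≤ midBump target (u , v , i , X , Y) c
        same refl = mid-left u v i X Y
        lem : ∀ A i κa κb p l bn L bm → A + 2 + i * (κa + 1 + κb) + κa + l + bm + L + (κb + p + bn)
          ≡ A + 1 + suc i * (κa + 1 + κb) + (l + p) + bn + (bm + L) + 0
        lem = solve-∀

      φ-down : ∀ c → φ (start c) ≤ φ (end c) + len c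
      φ-down (hang source e) with e ≤? eS
      ... | no _ = ≤-trans (m≤m+n A (gateLam e + bp + hangLength e)) (≤-reflexive (lem A (gateLam e) bp (hangLength e)))
        where
        bp : ℕ
        bp = nodeBump (slot e) v★ 0 (gateX e) (gateY e)
        lem : ∀ A l n h → A + (l + n + h) ≡ A + l + n + h
        lem = solve-∀
      ... | yes e≤ = cancel-≤ (hangLength eS + gateLam e + bp) (+-mono-≤ (≤-trans (gateLam-≤ eS) (R≤hang e)) e≤)
          (lem eS (hangLength eS) (gateLam e) bp (hangLength e) (gateLam eS) e)
        where
        bp : ℕ
        bp = nodeBump (slot e) v★ 0 (gateX e) (gateY e)
        lem : ∀ f h l n he g e → f + h + l + n + he + (g + e) ≡ g + e + (he + f) + (h + l + n)
        lem = solve-∀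
      φ-down (hang target e) with e ≤? eT
      ... | no _ = ≤-trans (m≤m+n B (gateLam e + targetBump e + hangLength e)) (≤-reflexive (lem B (gateLam e) (targetBump e) (hangLength e)))
        where
        lem : ∀ A l n h → A + (l + n + h) ≡ A + l + n + h
        lem = solve-∀
      ... | yes e≤ with m≤n⇒m<n∨m≡n e≤
      ...   | inj₂ refl = ≤-reflexive (begin
        B + gateLam e + 2 * m + hangLength e + (e ∸ e) ≡⟨ cong (B + gateLam e + 2 * m + hangLength e +_) (n∸n≡0 e) ⟩
        B + gateLam e + 2 * m + hangLength e + 0       ≡⟨ +-identityʳ _ ⟩
        B + gateLam e + 2 * m + hangLength e           ≡⟨ cong (λ z → B + gateLam e + z + hangLength e) targetBump-tip ⟨
        B + gateLam e + targetBump e + hangLength e    ∎)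
        where open ≡-Reasoning
      ...   | inj₁ e< with slack , drop , close ← hang-drop e< eT<K =
        cancel-≤ (targetBump e) (+-mono-≤ drop (gateLam-close {eT} {e} (reverse close)))
          (lem B (gateLam e) (targetBump e) (hangLength e) (hangLength eT) (2 * m) (eT ∸ e) slack (gateLam eT))
        where
        reverse : ∀ {s} → e / U ≡ eT / U ⊎ R ≤ s → eT / U ≡ e / U ⊎ R ≤ s
        reverse (inj₁ eq) = inj₁ (sym eq)
        reverse (inj₂ R≤) = inj₂ R≤
        lem : ∀ B l n he h w t s g → B + l + n + he + (h + w + t + s + g) ≡ B + g + w + h + t + (he + (l + s)) + n
        lem = solve-∀
      φ-down (link source (u , v , i , X , Y) c) =
        cancel-≤ (κa + 4 * m * dot a c + midBump source (u , v , i , X ⊕ c , Y) c + 2 * m * dot c c)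
          (≤-trans (nodeBump-≤ u (tag v i) i X Y) 2m≤D)
          (trans (cong (λ z → A + 1 + i * κ + κa + z + midBump source (u , v , i , X ⊕ c , Y) c + linkLength c + nodeBump u (tag v i) i X Y) (lam-⊕ˡ a b X Y c))
            (lem A (i * κ) κa (4 * m * dot a c) (lam a b X Y) (midBump source (u , v , i , X ⊕ c , Y) c) D (2 * m * dot c c) (nodeBump u (tag v i) i X Y)))
        where
        lem : ∀ A s κa p l bm D q bn → A + 1 + s + κa + (l + p) + bm + (D + q) + bn ≡ A + 1 + s + l + bn + D + (κa + p + bm + q)
        lem = solve-∀
      φ-down (link target (u , v , i , X , Y) c) =
        cancel-≤ (κb + 4 * m * dot b c + nodeBump u v (suc i) X (Y ⊕ c) + 2 * m * dot c c)
          (≤-trans (midBump-≤ target (u , v , i , X , Y) c) 2m≤D)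
          (trans (cong (λ z → A + 1 + suc i * κ + z + nodeBump u v (suc i) X (Y ⊕ c) + linkLength c + midBump target (u , v , i , X , Y) c) (lam-⊕ʳ a b X Y c))
            (lem A i κa κb (4 * m * dot b c) (lam a b X Y) (midBump target (u , v , i , X , Y) c) D (2 * m * dot c c) (nodeBump u v (suc i) X (Y ⊕ c))))
        where
        lem : ∀ A i κa κb p l bm D q bn → A + 1 + suc i * (κa + 1 + κb) + (l + p) + bn + (D + q) + bm
          ≡ A + 2 + i * (κa + 1 + κb) + κa + l + bm + D + (κb + p + bn + q)
        lem = solve-∀

      -- Along the route the tangent touches the link cost, so the potential grows by exactly the
      -- route length, and the full bonus comes on top.
      potential-gain : φ (path target 0) ≡ φ (path source 0) + routeLength + 2 * m
      potential-gain with 0 ≤? eT | 0 ≤? eS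
      ... | no ≰  | _     = contradiction z≤n ≰
      ... | yes _ | no ≰  = contradiction z≤n ≰
      ... | yes _ | yes _ = begin
        B + gateLam eT + 2 * m + hangLength eT + eT
          ≡⟨ cong (λ z → B + z + 2 * m + hangLength eT + eT) gateLam-T ⟩
        B + (gateLam eS + k * (4 * m * (dot a a + dot b b))) + 2 * m + hangLength eT + eT
          ≡⟨ lem eS (hangLength eS) k κa κb (gateLam eS) m (dot a a) (dot b b) (hangLength eT) eT ⟩
        gateLam eS + 0 + (eS + (hangLength eS + (1 + (k * (κa + 2 * m * dot a a + 2 * m * dot a a + (1 + (κb + 2 * m * dot b b + 2 * m * dot b b)))
          + (1 + (hangLength eT + eT)))))) + 2 * m
          ≡⟨ cong₂ (λ s t → gateLam eS + 0 + (eS + (hangLength eS + (1 + (k * (s + 2 * m * dot a a + (1 + (t + 2 * m * dot b b)))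
          + (1 + (hangLength eT + eT)))))) + 2 * m) (surplus-+ a<) (surplus-+ b<) ⟨
        gateLam eS + 0 + routeLength + 2 * m ∎
        where
        open ≡-Reasoning
        lem : ∀ e h k κa κb g m s t h′ e′ →
          e + h + 2 + k * (κa + 1 + κb) + (g + k * (4 * m * (s + t))) + 2 * m + h′ + e′
          ≡ g + 0 + (e + (h + (1 + (k * (κa + 2 * m * s + 2 * m * s + (1 + (κb + 2 * m * t + 2 * m * t)))
          + (1 + (h′ + e′)))))) + 2 * m
        lem = solve-∀

      open Potential φ φ-up φ-down public using (Φ; near)

-- From the potential to the edge count of a preserver

length-deduplicate-≤ : ∀ {A : Set} (_≟_ : DecidableEquality A) xs → length (deduplicate _≟_ xs) ≤ length xs
length-deduplicate-≤ _≟_ [] = z≤n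
length-deduplicate-≤ _≟_ (x ∷ xs) =
  s≤s (≤-trans (length-filter (λ y → ¬? (x ≟ y)) (deduplicate _≟_ xs)) (length-deduplicate-≤ _≟_ xs))

bool→ℕ-≤1 : ∀ b → bool→ℕ b ≤ 1
bool→ℕ-≤1 true  = ≤-refl
bool→ℕ-≤1 false = z≤n

tally : (ℕ → Bool) → ℕ → ℕ
tally p zero    = 0
tally p (suc i) = tally p i + bool→ℕ (p i)

tally-not : ∀ p i → tally p i + tally (not ∘ p) i ≡ i
tally-not p zero = refl
tally-not p (suc i) with p i
... | true  = trans (lem (tally p i) (tally (not ∘ p) i)) (cong suc (tally-not p i))
  where
  lem : ∀ s t → s + 1 + (t + 0) ≡ suc (s + t)
  lem = solve-∀
... | false = trans (lem (tally p i) (tally (not ∘ p) i)) (cong suc (tally-not p i))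
  where
  lem : ∀ s t → s + 0 + (t + 1) ≡ suc (s + t)
  lem = solve-∀

tally≡sum : ∀ p i → tally p i ≡ sum (map (bool→ℕ ∘ p) (upTo i))
tally≡sum p zero = refl
tally≡sum p (suc i) = begin
  tally p i + bool→ℕ (p i)                                     ≡⟨ cong₂ _+_ (tally≡sum p i) (sym (+-identityʳ _)) ⟩
  sum (map f (upTo i)) + sum (map f (i ∷ []))                  ≡⟨ sum-++ (map f (upTo i)) _ ⟨
  sum (map f (upTo i) ++ map f (i ∷ []))             ≡⟨ cong sum (map-++ f (upTo i) (i ∷ [])) ⟨
  sum (map f (upTo i ++ i ∷ []))                     ≡⟨ cong (sum ∘ map f) (upTo-∷ʳ i) ⟩
  sum (map f (upTo (suc i)))                                   ∎
  where
  open ≡-Reasoning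
  f : ℕ → ℕ
  f = bool→ℕ ∘ p

-- Removing the common `i * a` leaves `k x`, and `k` is positive. This recovers the starting port
-- from a private edge.
line-cancel : ∀ {d} k (x x′ a : Vec ℕ d) i → 1 ≤ k → line k x a i ≡ line k x′ a i → x ≡ x′
line-cancel k [] [] [] i 1≤k eq = refl
line-cancel k@(suc _) (x ∷ xs) (x′ ∷ xs′) (a ∷ as) i 1≤k eq =
  cong₂ _∷_ (*-cancelˡ-≡ x x′ k (+-cancelʳ-≡ (i * a) (k * x) (k * x′) (Vecₚ.∷-injectiveˡ eq)))
            (line-cancel k xs xs′ as i 1≤k (Vecₚ.∷-injectiveʳ eq))

module Finite (d k r U m D R : ℕ) {{nzU : NonZero U}}
  (1≤k : 1 ≤ k) (1≤r : 1 ≤ r) (1≤m : 1 ≤ m) (2m≤D : 2 * m ≤ D) (square≤D : 2 * m * (d * (r * r)) ≤ D)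
  (lam≤R : 4 * m * (d * (r * (2 * r * k)) + d * (r * (2 * r * k))) ≤ R)
  (n : ℕ) (size≤n : Construction.size d k r U m D R ≤ n) where

  open Construction d k r U m D R
  open Demand d k r U m D R 1≤k 1≤r 1≤m 2m≤D square≤D lam≤R

  abstract
    -- Deduplication makes the labelling injective and can only shorten the list, so it still fits
    -- into `n` positions; the rest are filled by junk hubs.
    distinct : List Vertex
    distinct = deduplicate _≟V_ vertices

    label : Fin n → Vertex
    label i = nth (hub ∘ junk) distinct (toℕ i)

    label-injective : Injective _≡_ _≡_ label
    label-injective {i} {j} eq = toℕ-injective (nth-injective (hub ∘ junk) (λ { refl → refl })
      (λ h → junk∉ (∈-deduplicate⁻ _≟V_ vertices h)) (deduplicate-! _≟V_ vertices) (toℕ i) (toℕ j) eq)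

    index : ∀ {v} → v ∈ vertices → ∃ λ i → label i ≡ v
    index v∈ with i , i< , eq ← ∈⇒nth (hub ∘ junk) (∈-deduplicate⁺ _≟V_ v∈) =
      fromℕ< i<n , trans (cong (nth (hub ∘ junk) distinct) (toℕ-fromℕ< i<n)) eq
      where
      i<n : i < n
      i<n = <-≤-trans i< (≤-trans (length-deduplicate-≤ _≟V_ vertices)
        (≤-trans (≤-reflexive (HasLength.proof length-vertices)) size≤n))

  open Labelled _≟V_ Edge edge? loopless label label-injective using (graph; adj⁺; adj⁻; find; label-find) public

  origin destination : Fin n
  origin      = proj₁ (index (path∈ source z≤n))
  destination = proj₁ (index (path∈ target z≤n))

  locate : Vertex → Fin n
  locate = find origin

  locate-label : ∀ {v i} → label i ≡ v → locate v ≡ i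
  locate-label {v} {i} eq = label-injective (trans (label-find origin v (i , eq)) (sym eq))

  label-locate : ∀ {v} → v ∈ vertices → label (locate v) ≡ v
  label-locate {v} v∈ = label-find origin v (index v∈)

  module Preserver (β : ℕ) (β<2m : β < 2 * m) (H : Graph n) (H⊆G : H ⊆G graph)
    (preserver : FTPreserver2 graph H β origin destination) where

    module Bound (u★ v★ : ℕ) (x y a b : Vec ℕ d) (eS eT : ℕ)
      (u< : u★ < U) (v< : v★ < U) (x< : Bounded r x) (y< : Bounded r y) (a< : Bounded r a) (b< : Bounded r b)
      (eS<K : eS < K) (eT<K : eT < K) (slot-S : slot eS ≡ u★) (slot-T : slot eT ≡ v★)
      (port-S : port eS ≡ (x , y)) (port-T : port eT ≡ (x ⊕ a , y ⊕ b)) where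

      open Pair u★ v★ x y a b eS eT u< v< x< y< a< b< eS<K eT<K slot-S slot-T port-S port-T

      has : ℕ → Bool
      has i = adj H (locate (hub (mid source (place i) a))) (locate (hub (mid target (place i) b)))

      fault : Side → Fin n × Fin n
      fault s = proj₁ (index (path∈ s (<⇒≤ (tip<K s)))) , proj₁ (index (path∈ s (tip<K s)))

      fault-label : ∀ s → label (proj₁ (fault s)) ≡ hub (path s (tip s)) × label (proj₂ (fault s)) ≡ hub (path s (suc (tip s)))
      fault-label s = proj₂ (index (path∈ s (<⇒≤ (tip<K s)))) , proj₂ (index (path∈ s (tip<K s)))

      faults : List (Fin n × Fin n)
      faults = fault source ∷ fault target ∷ []

      fault∈ : ∀ s → fault s ∈ faults
      fault∈ source = here refl
      fault∈ target = there (here refl)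

      ∈faults : ∀ {e} → e ∈ faults → ∃ λ s → e ≡ fault s
      ∈faults (here eq)         = source , eq
      ∈faults (there (here eq)) = target , eq

      fault-edge : ∀ s → adj graph (proj₁ (fault s)) (proj₂ (fault s)) ≡ true
      fault-edge s = adj⁺ _ _ (inj₁ (subst₂ Edge (sym (proj₁ (fault-label s))) (sym (proj₂ (fault-label s))) (join (along s (tip s)))))

      same⇒cut : ∀ {e i j} → e ∈ faults → SameEdge e i j → Cut (label i) (label j) ⊎ Cut (label j) (label i)
      same⇒cut e∈ = go (∈faults e∈)
        where
        go : ∀ {e i j} → (∃ λ s → e ≡ fault s) → SameEdge e i j → Cut (label i) (label j) ⊎ Cut (label j) (label i)
        go (s , refl) (inj₁ (refl , refl)) = inj₁ (s , fault-label s)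
        go (s , refl) (inj₂ (refl , refl)) = inj₂ (s , fault-label s)

      cut⇒same : ∀ {i j} → Cut (label i) (label j) → ∃ λ e → e ∈ faults × e ≡ (i , j)
      cut⇒same (s , p , q) = fault s , fault∈ s , cong₂ _,_
        (label-injective (trans (proj₁ (fault-label s)) (sym p)))
        (label-injective (trans (proj₂ (fault-label s)) (sym q)))

      step⇒adj : ∀ i w → Step (label i) w → ∃ λ j → label j ≡ w × remove (adj graph) faults i j ≡ true
      step⇒adj i w (linked , _ , w∈ , ¬cut , ¬cut′) = go (index w∈)
        where
        go : (∃ λ j → label j ≡ w) → ∃ λ j → label j ≡ w × remove (adj graph) faults i j ≡ true
        go (j , refl) = j , refl , remove⁺ (adj graph) faults (adj⁺ i j linked)
          λ e∈ same → Sum.[ ¬cut , ¬cut′ ] (same⇒cut e∈ same)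

      route-walk : Walk (remove (adj graph) faults) origin destination routeLength
      route-walk = go (trail⇒walk label _ step⇒adj route origin (proj₂ (index (path∈ source z≤n))))
        where
        go : ∀ {l} → (∃ λ j → label j ≡ hub (path target 0) × Walk (remove (adj graph) faults) origin j l) →
          Walk (remove (adj graph) faults) origin destination l
        go (j , eq , w) = subst (λ j → Walk (remove (adj graph) faults) origin j _) (label-injective (trans eq (sym (proj₂ (index (path∈ target z≤n)))))) w

      -- Each missing private edge is charged a detour of 2, until `m` of them have been charged.
      missing bonus : ℕ → ℕ
      missing = tally (not ∘ has)
      bonus i = 2 * (m ⊓ missing i)

      -- With `m` edges missing, the potential shows that every walk from `origin` to `destination`
      -- left in `H` is at least `2 * m` longer than the route. The preserver permits an excess of
      -- only `β`, which is smaller.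
      few-missing : missing k < m
      few-missing = ≰⇒> λ full → contradiction (2m≤β full) (<⇒≱ β<2m)
        where
        module _ (full : m ≤ missing k) where
          up : ∀ i → missing i ≤ missing (suc i)
          up i = m≤m+n (missing i) _
          step-up : ∀ i → missing (suc i) ≤ suc (missing i)
          step-up i = ≤-trans (+-monoʳ-≤ (missing i) (bool→ℕ-≤1 (not (has i)))) (≤-reflexive (+-comm (missing i) 1))
          bonus-step : ∀ i → bonus (suc i) ≤ 2 + bonus i
          bonus-step i = ≤-trans (*-monoʳ-≤ 2 (≤-trans (⊓-monoʳ-≤ m (step-up i)) (⊓-monoˡ-≤ (suc (missing i)) (n≤1+n m))))
            (≤-reflexive (*-suc 2 (m ⊓ missing i)))

          open Lower bonus (cong (2 *_) (⊓-zeroʳ m)) (λ i → *-monoʳ-≤ 2 (⊓-monoʳ-≤ m (up i))) bonus-step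
            (λ i → *-monoʳ-≤ 2 (m⊓n≤m m (missing i))) (cong (2 *_) (m≤n⇒m⊓n≡m full))

          kept : ∀ l → has l ≡ true → bonus (suc l) ≤ bonus l
          kept l eq = ≤-reflexive (cong (λ z → 2 * (m ⊓ z))
            (trans (cong (λ z → missing l + bool→ℕ (not z)) eq) (+-identityʳ (missing l))))

          edge-near : ∀ i j → Edge (label i) (label j) → adj H i j ≡ true → (∀ {e} → e ∈ faults → ¬ SameEdge e i j) →
            Φ (label j) ≤ suc (Φ (label i)) × Φ (label i) ≤ suc (Φ (label j))
          edge-near i j e h safe = near e λ {p} {q} p≡ q≡ pq → joined-near pq
            (λ (s , p≡′ , q≡′) → unsafe s (trans p≡ (cong hub p≡′)) (trans q≡ (cong hub q≡′)))
            -- An edge of `H` whose labels are the ends of the private edge at layer `l` is the one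
            -- tested by `has l`, so the bonus does not rise there.
            (λ l p≡′ q≡′ → kept l (trans (cong₂ (adj H) (locate-label (trans p≡ (cong hub p≡′))) (locate-label (trans q≡ (cong hub q≡′)))) h))
            where
            unsafe : ∀ s → label i ≡ hub (path s (tip s)) → ¬ label j ≡ hub (path s (suc (tip s)))
            unsafe s p≡ q≡ = let e , e∈ , e≡ = cut⇒same {i} {j} (s , p≡ , q≡) in
              safe e∈ (inj₁ (cong proj₁ e≡ , cong proj₂ e≡))

          lipschitz : ∀ i j → remove (adj H) faults i j ≡ true → Φ (label j) ≤ suc (Φ (label i))
          lipschitz i j r = go (remove⁻ (adj H) faults r)
            where
            swapped : ∀ {e} → SameEdge e j i → SameEdge e i j
            swapped (inj₁ p) = inj₂ p
            swapped (inj₂ p) = inj₁ p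
            go : adj H i j ≡ true × (∀ {e} → e ∈ faults → ¬ SameEdge e i j) → Φ (label j) ≤ suc (Φ (label i))
            go (h , safe) = Sum.[ (λ e → proj₁ (edge-near i j e h safe))
              , (λ e → proj₂ (edge-near j i e (trans (adj-sym H j i) h) λ e∈ same → safe e∈ (swapped same))) ]
              (adj⁻ i j (H⊆G i j h))

          2m≤β : 2 * m ≤ β
          2m≤β = go (preserver faults ≤-refl
              (fault-edge source LAll.∷ fault-edge target LAll.∷ LAll.[]) routeLength route-walk)
            where
            open ≤-Reasoning
            go : (Σ ℕ λ l → l ≤ routeLength + β × Walk (remove (adj H) faults) origin destination l) → 2 * m ≤ β
            go (l , l≤ , w) = +-cancelˡ-≤ (φ (path source 0) + routeLength) (2 * m) β (begin
              φ (path source 0) + routeLength + 2 * m ≡⟨ potential-gain ⟨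
              φ (path target 0)                       ≡⟨ cong Φ (proj₂ (index (path∈ target z≤n))) ⟨
              Φ (label destination)                   ≤⟨ walk-length (Φ ∘ label) lipschitz w ⟩
              Φ (label origin) + l                    ≡⟨ cong (λ v → Φ v + l) (proj₂ (index (path∈ source z≤n))) ⟩
              φ (path source 0) + l                   ≤⟨ +-monoʳ-≤ (φ (path source 0)) l≤ ⟩
              φ (path source 0) + (routeLength + β)   ≡⟨ +-assoc (φ (path source 0)) routeLength β ⟨
              φ (path source 0) + routeLength + β     ∎)

      kept-edges : k ∸ m ≤ sum (map (bool→ℕ ∘ has) (upTo k))
      kept-edges = begin
        k ∸ m                                          ≡⟨ cong (_∸ m) (tally-not has k) ⟨
        tally has k + missing k ∸ m                    ≤⟨ ∸-monoˡ-≤ m (+-monoʳ-≤ (tally has k) (<⇒≤ few-missing)) ⟩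
        tally has k + m ∸ m                            ≡⟨ m+n∸n≡m (tally has k) m ⟩
        tally has k                                    ≡⟨ tally≡sum has k ⟩
        sum (map (bool→ℕ ∘ has) (upTo k))              ∎
        where open ≤-Reasoning

    port-index : ∀ {x y u} → Bounded (2 * r) x → Bounded (2 * r) y → u < U →
      ∃ λ e → e < K × slot e ≡ u × port e ≡ (x , y)
    port-index {x} {y} {u} x< y< u< = go (∈⇒nth (λ _ → replicate d 0 , replicate d 0)
      (∈-cartesianProduct⁺ (∈-vectors⁺ x<) (∈-vectors⁺ y<)))
      where
      go : (∃ λ ξ → ξ < K₀ × nth (λ _ → replicate d 0 , replicate d 0) ports ξ ≡ (x , y)) →
        ∃ λ e → e < K × slot e ≡ u × port e ≡ (x , y)
      -- The terminal in slot `u` at port number `ξ`: division by `U` returns `ξ`, the remainder is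
      -- `u`.
      go (ξ , ξ< , eq) = u + ξ * U
        , <-≤-trans (+-monoˡ-< (ξ * U) u<) (*-monoˡ-≤ U ξ<)
        , trans ([m+kn]%n≡m%n u ξ U) (m<n⇒m%n≡m u<)
        , trans (cong (nth _ ports) quotient) eq
        where
        quotient : (u + ξ * U) / U ≡ ξ
        quotient = trans (+-distrib-/-∣ʳ u (divides-refl ξ)) (cong₂ _+_ (m<n⇒m/n≡0 u<) (m*n/n≡m ξ U))

    -- `(u , v , x , y , a , b)` encodes the pair of terminals in slots `u` and `v` at the ports
    -- `(x , y)` and `(x ⊕ a , y ⊕ b)`.
    Request : Set
    Request = ℕ × ℕ × Vec ℕ d × Vec ℕ d × Vec ℕ d × Vec ℕ d

    requests : List Request
    requests = cartesianProduct (upTo U) (cartesianProduct (upTo U) (cartesianProduct V (cartesianProduct V (cartesianProduct V V))))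
      where
      V : List (Vec ℕ d)
      V = vectors r d

    Valid : Request → Set
    Valid (u , v , x , y , a , b) = u < U × v < U × Bounded r x × Bounded r y × Bounded r a × Bounded r b

    requests-valid : ∀ {q} → q ∈ requests → Valid q
    requests-valid q∈ =
      let u∈ , q∈ = ∈-cartesianProduct⁻ (upTo U) _ q∈
          v∈ , q∈ = ∈-cartesianProduct⁻ (upTo U) _ q∈
          x∈ , q∈ = ∈-cartesianProduct⁻ (vectors r d) _ q∈
          y∈ , q∈ = ∈-cartesianProduct⁻ (vectors r d) _ q∈
          a∈ , b∈ = ∈-cartesianProduct⁻ (vectors r d) _ q∈
      in ∈-upTo⁻ u∈ , ∈-upTo⁻ v∈ , ∈-vectors⁻ x∈ , ∈-vectors⁻ y∈ , ∈-vectors⁻ a∈ , ∈-vectors⁻ b∈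

    hasLength-requests : HasLength requests (U * (U * (r ^ d * (r ^ d * (r ^ d * r ^ d)))))
    hasLength-requests = hasLength-× (hasLength-upTo U) (hasLength-× (hasLength-upTo U)
      (hasLength-× V (hasLength-× V (hasLength-× V V))))
      where
      V : HasLength (vectors r d) (r ^ d)
      V = hasLength-vectors r d

    midA midB : Request → ℕ → Vertex
    midA (u , v , x , y , a , b) i = hub (mid source (u , v , i , line k x a (suc i) , line k y b i) a)
    midB (u , v , x , y , a , b) i = hub (mid target (u , v , i , line k x a (suc i) , line k y b i) b)

    mids∈ : ∀ {q i} → Valid q → i < k → midA q i ∈ vertices × midB q i ∈ vertices
    mids∈ (u< , v< , x< , y< , a< , b<) i<k = mid∈ source inBox a< , mid∈ target inBox b<
      where
      inBox : InBox k _
      inBox = u< , v< , i<k , line-bounded 1≤k x< a< i<k , line-bounded 1≤k y< b< (<⇒≤ i<k)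

    -- The ends of a private edge show copy, layer and both directions; `line-cancel` then yields
    -- `x` and `y`. Hence no edge is private to two pairs or at two layers.
    mids-injective : ∀ {q q′ i i′} → midA q i ≡ midA q′ i′ → midB q i ≡ midB q′ i′ → (q , i) ≡ (q′ , i′)
    mids-injective {u , v , x , y , a , b} {u′ , v′ , x′ , y′ , a′ , b′} {i} {i′} p q = go (cong getA p) (cong getB q)
      where
      getA getB : Vertex → Place d × Vec ℕ d
      getA (hub (mid source p a)) = p , a
      getA _                      = (u , v , i , x , y) , a
      getB (hub (mid target p b)) = p , b
      getB _                      = (u , v , i , x , y) , b
      go : ((u , v , i , line k x a (suc i) , line k y b i) , a) ≡ ((u′ , v′ , i′ , line k x′ a′ (suc i′) , line k y′ b′ i′) , a′) →
        ((u , v , i , line k x a (suc i) , line k y b i) , b) ≡ ((u′ , v′ , i′ , line k x′ a′ (suc i′) , line k y′ b′ i′) , b′) →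
        ((u , v , x , y , a , b) , i) ≡ ((u′ , v′ , x′ , y′ , a′ , b′) , i′)
      go eqA eqB with cong (proj₁ ∘ proj₁) eqA | cong (proj₁ ∘ proj₂ ∘ proj₁) eqA | cong (proj₁ ∘ proj₂ ∘ proj₂ ∘ proj₁) eqA
        | cong proj₂ eqA | cong proj₂ eqB
      ... | refl | refl | refl | refl | refl = cong₂ (λ x y → (u , v , x , y , a , b) , i)
        (line-cancel k x x′ a (suc i) 1≤k (cong (proj₁ ∘ proj₂ ∘ proj₂ ∘ proj₂ ∘ proj₁) eqA))
        (line-cancel k y y′ b i 1≤k (cong (proj₂ ∘ proj₂ ∘ proj₂ ∘ proj₂ ∘ proj₁) eqA))

    kept : Request → ℕ → ℕ
    kept q i = bool→ℕ (adj H (locate (midA q i)) (locate (midB q i)))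

    kept-many : ∀ {q} → Valid q → k ∸ m ≤ sum (map (kept q) (upTo k))
    kept-many {u , v , x , y , a , b} (u< , v< , x< , y< , a< , b<) =
      go (port-index (widen x<) (widen y<) u<) (port-index (⊕-bounded x< a<) (⊕-bounded y< b<) v<)
      where
      widen : ∀ {x} → Bounded r x → Bounded (2 * r) x
      widen = VAll.map (λ z< → <-≤-trans z< (m≤m+n r _))
      go : (∃ λ e → e < K × slot e ≡ u × port e ≡ (x , y)) →
        (∃ λ e → e < K × slot e ≡ v × port e ≡ (x ⊕ a , y ⊕ b)) →
        k ∸ m ≤ sum (map (kept (u , v , x , y , a , b)) (upTo k))
      go (eS , eS<K , slot-S , port-S) (eT , eT<K , slot-T , port-T) =
        Bound.kept-edges u v x y a b eS eT u< v< x< y< a< b< eS<K eT<K slot-S slot-T port-S port-T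

    -- The bounds `kept-many` of all requests add up, since the private edges are pairwise distinct
    -- and source mids never coincide with target mids.
    many-edges : U * (U * (r ^ d * (r ^ d * (r ^ d * r ^ d)))) * (k ∸ m) ≤ edgeCount H
    many-edges = begin
      U * (U * (r ^ d * (r ^ d * (r ^ d * r ^ d)))) * (k ∸ m)
        ≡⟨ cong (_* (k ∸ m)) (HasLength.proof hasLength-requests) ⟨
      length requests * (k ∸ m)
        ≤⟨ sum-map-≥ (λ q → sum (map (kept q) (upTo k))) (k ∸ m) requests (λ q∈ → kept-many (requests-valid q∈)) ⟩
      sum (map (λ q → sum (map (kept q) (upTo k))) requests)
        ≡⟨ sum-cartesianProduct kept requests (upTo k) ⟨
      sum (map (uncurry kept) codes)
        ≤⟨ edgeCount-≥ H codes (λ (q , i) → locate (midA q i)) (λ (q , i) → locate (midB q i))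
             codes-unique
             (λ c∈ c′∈ p q → mids-injective (unlocate (proj₁ (code∈ c∈)) (proj₁ (code∈ c′∈)) p)
                                            (unlocate (proj₂ (code∈ c∈)) (proj₂ (code∈ c′∈)) q))
             (λ c∈ c′∈ p → A≢B (unlocate (proj₁ (code∈ c∈)) (proj₂ (code∈ c′∈)) p)) ⟩
      edgeCount H ∎
      where
      open ≤-Reasoning
      codes : List (Request × ℕ)
      codes = cartesianProduct requests (upTo k)
      V! : Unique (vectors r d)
      V! = vectors-unique r d
      codes-unique : Unique codes
      codes-unique = Uniq.cartesianProduct⁺ (Uniq.cartesianProduct⁺ (Uniq.upTo⁺ U) (Uniq.cartesianProduct⁺ (Uniq.upTo⁺ U)
        (Uniq.cartesianProduct⁺ V! (Uniq.cartesianProduct⁺ V! (Uniq.cartesianProduct⁺ V! V!))))) (Uniq.upTo⁺ k)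
      code∈ : ∀ {c} → c ∈ codes → midA (proj₁ c) (proj₂ c) ∈ vertices × midB (proj₁ c) (proj₂ c) ∈ vertices
      code∈ c∈ = let q∈ , i∈ = ∈-cartesianProduct⁻ requests (upTo k) c∈ in mids∈ (requests-valid q∈) (∈-upTo⁻ i∈)
      unlocate : ∀ {v w} → v ∈ vertices → w ∈ vertices → locate v ≡ locate w → v ≡ w
      unlocate v∈ w∈ eq = trans (sym (label-locate v∈)) (trans (cong label eq) (label-locate w∈))
      A≢B : ∀ {q i q′ i′} → midA q i ≢ midB q′ i′
      A≢B ()

-- Choice of the parameters

-- Upward search from `c`. A base whose power is at most `n` is itself at most `n`, so the fuel
-- `suc n` cannot run out.
integer-root : ∀ B c n → 1 ≤ B → c ^ B ≤ n → ∃ λ g → c ≤ g × g ^ B ≤ n × n < suc g ^ B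
integer-root (suc b) c n _ c≤ = search (suc n) c (m≤n+m (suc n) c) c≤
  where
  ≤-power : ∀ g → g ≤ g ^ suc b
  ≤-power zero    = z≤n
  ≤-power (suc g) = m≤m*n (suc g) (suc g ^ b) {{m^n≢0 (suc g) b}}
  search : ∀ fuel g → n < g + fuel → g ^ suc b ≤ n → ∃ λ h → g ≤ h × h ^ suc b ≤ n × n < suc h ^ suc b
  search zero g n< g≤ = contradiction (≤-trans (≤-power g) g≤) (<⇒≱ (subst (n <_) (+-identityʳ g) n<))
  search (suc fuel) g n< g≤ with suc g ^ suc b ≤? n
  ... | no  ≰ = g , ≤-refl , g≤ , ≰⇒> ≰
  ... | yes ≤n with h , g<h , h≤ , n<h ← search fuel (suc g) (subst (n <_) (+-suc g fuel) n<) ≤n =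
    h , <⇒≤ g<h , h≤ , n<h

-- Here `d = 3` and `m = g`. There are about `U² k⁷ r⁹` links of length about `g r²`, and `k⁷ = r`
-- turns this into `g U² r¹²`, which is `vol`. The choice `U = k r²` makes `R` of order `g U`, so
-- the roughly `r⁶ U` hanging chains of length about `g r⁶ U` take up the same order of vertices.
module Size (g k r U : ℕ) {{_ : NonZero U}} (1≤g : 1 ≤ g) (1≤k : 1 ≤ k) (1≤r : 1 ≤ r)
  (k^7≡r : k ^ 7 ≡ r) (U≡ : U ≡ k * (r * r)) where

  D R r⁶ vol : ℕ
  D  = 6 * g * (r * r)
  R  = 4 * g * (3 * (r * (2 * r * k)) + 3 * (r * (2 * r * k)))
  r⁶ = r * r * r * (r * r * r)
  vol  = g * (U * U) * (r⁶ * r⁶)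

  open Construction 3 k r U g D R

  infixr 7 _⊛_
  _⊛_ : ∀ {a b} → 1 ≤ a → 1 ≤ b → 1 ≤ a * b
  p ⊛ q = *-mono-≤ p q

  1≤U : 1 ≤ U
  1≤U = subst (1 ≤_) (sym U≡) (1≤k ⊛ 1≤r ⊛ 1≤r)

  1≤r³ : 1 ≤ r * r * r
  1≤r³ = (1≤r ⊛ 1≤r) ⊛ 1≤r

  1≤r⁶ : 1 ≤ r⁶
  1≤r⁶ = 1≤r³ ⊛ 1≤r³

  absorb : ∀ s u {t} → 1 ≤ u → t ≡ s * u → s ≤ t
  absorb s u 1≤u refl = ≤-trans (≤-reflexive (sym (*-identityʳ s))) (*-monoʳ-≤ s 1≤u)

  K≡ : K ≡ 64 * (r⁶ * U)
  K≡ = trans (cong (_* U) K₀≡) (lem r U)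
    where
    lem : ∀ r U → 2 * r * (2 * r * (2 * r * 1)) * (2 * r * (2 * r * (2 * r * 1))) * U ≡ 64 * (r * r * r * (r * r * r) * U)
    lem = solve-∀

  r⁶U≤vol : r⁶ * U ≤ vol
  r⁶U≤vol = absorb (r⁶ * U) (g * U * r⁶) ((1≤g ⊛ 1≤U) ⊛ 1≤r⁶) (lem g U r⁶)
    where
    lem : ∀ g U s → g * (U * U) * (s * s) ≡ s * U * (g * U * s)
    lem = solve-∀

  K≤ : K ≤ 64 * vol
  K≤ = ≤-trans (≤-reflexive K≡) (*-monoʳ-≤ 64 r⁶U≤vol)

  grid : U * (U * (k * (Z ^ 3 * Z ^ 3))) ≡ 64 * (U * U * r⁶ * r)
  grid = trans (lem U k r) (cong (λ z → 64 * (U * U * r⁶ * z)) k^7≡r)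
    where
    lem : ∀ U k r → U * (U * (k * (2 * r * k * (2 * r * k * (2 * r * k * 1)) * (2 * r * k * (2 * r * k * (2 * r * k * 1))))))
      ≡ 64 * (U * U * (r * r * r * (r * r * r)) * (k * (k * (k * (k * (k * (k * (k * 1))))))))
    lem = solve-∀

  nodes≤ : U * (U * (suc k * (Z ^ 3 * Z ^ 3))) ≤ 128 * vol
  nodes≤ = begin
    U * (U * (suc k * (Z ^ 3 * Z ^ 3)))   ≤⟨ *-monoʳ-≤ U (*-monoʳ-≤ U (*-monoˡ-≤ (Z ^ 3 * Z ^ 3) (+-monoˡ-≤ k 1≤k))) ⟩
    U * (U * ((k + k) * (Z ^ 3 * Z ^ 3))) ≡⟨ lem₁ U k (Z ^ 3 * Z ^ 3) ⟩
    2 * (U * (U * (k * (Z ^ 3 * Z ^ 3)))) ≡⟨ cong (2 *_) grid ⟩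
    2 * (64 * (U * U * r⁶ * r))           ≤⟨ *-monoʳ-≤ 2 (*-monoʳ-≤ 64 (absorb (U * U * r⁶ * r) (g * r * r * (r * r * r)) (((1≤g ⊛ 1≤r) ⊛ 1≤r) ⊛ 1≤r³) (lem₂ g U r))) ⟩
    2 * (64 * vol)                          ≡⟨ *-assoc 2 64 vol ⟨
    128 * vol                               ∎
    where
    open ≤-Reasoning
    lem₁ : ∀ U k z → U * (U * ((k + k) * z)) ≡ 2 * (U * (U * (k * z)))
    lem₁ = solve-∀
    lem₂ : ∀ g U r → g * (U * U) * (r * r * r * (r * r * r) * (r * r * r * (r * r * r)))
      ≡ U * U * (r * r * r * (r * r * r)) * r * (g * r * r * (r * r * r))
    lem₂ = solve-∀

  mids≡ : 2 * (U * (U * (k * (Z ^ 3 * Z ^ 3))) * r ^ 3) ≡ 128 * (U * U * r⁶ * r * (r * r * r))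
  mids≡ = trans (cong (λ z → 2 * (z * r ^ 3)) grid) (lem (U * U * r⁶ * r) r)
    where
    lem : ∀ s r → 2 * (64 * s * (r * (r * (r * 1)))) ≡ 128 * (s * (r * r * r))
    lem = solve-∀

  mids≤ : 2 * (U * (U * (k * (Z ^ 3 * Z ^ 3))) * r ^ 3) ≤ 128 * vol
  mids≤ = ≤-trans (≤-reflexive mids≡) (*-monoʳ-≤ 128 (absorb (U * U * r⁶ * r * (r * r * r)) (g * r * r) ((1≤g ⊛ 1≤r) ⊛ 1≤r) (lem g U r)))
    where
    lem : ∀ g U r → g * (U * U) * (r * r * r * (r * r * r) * (r * r * r * (r * r * r)))
      ≡ U * U * (r * r * r * (r * r * r)) * r * (r * r * r) * (g * r * r)
    lem = solve-∀

  links≤ : 2 * (U * (U * (k * (Z ^ 3 * Z ^ 3))) * r ^ 3) * Lmax ≤ vol * 1536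
  links≤ = ≤-reflexive (trans (cong (_* Lmax) mids≡) (lem g U r))
    where
    lem : ∀ g U r → 128 * (U * U * (r * r * r * (r * r * r)) * r * (r * r * r)) * (6 * g * (r * r) + 2 * g * (3 * (r * r)))
      ≡ g * (U * U) * (r * r * r * (r * r * r) * (r * r * r * (r * r * r))) * 1536
    lem = solve-∀

  R≡ : R ≡ 48 * (g * U)
  R≡ = trans (lem g k r) (cong (λ z → 48 * (g * z)) (sym U≡))
    where
    lem : ∀ g k r → 4 * g * (3 * (r * (2 * r * k)) + 3 * (r * (2 * r * k))) ≡ 48 * (g * (k * (r * r)))
    lem = solve-∀

  K₀R≡ : K₀ * R ≡ r⁶ * U * g * 3072
  K₀R≡ = trans (cong₂ _*_ K₀≡ R≡) (lem r U g)
    where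
    lem : ∀ r U g → 2 * r * (2 * r * (2 * r * 1)) * (2 * r * (2 * r * (2 * r * 1))) * (48 * (g * U)) ≡ r * r * r * (r * r * r) * U * g * 3072
    lem = solve-∀

  Hmax≤ : Hmax ≤ r⁶ * U * g * 3314
  Hmax≤ = begin
    K₀ * R + K * (2 * g + 1) + (R + 2 * g)
      ≤⟨ +-mono-≤ (+-mono-≤ (≤-reflexive K₀R≡) slopes) (+-mono-≤ range shift) ⟩
    s * 3072 + s * 192 + (48 * s + 2 * s) ≡⟨ lem s ⟩
    s * 3314 ∎
    where
    open ≤-Reasoning
    s : ℕ
    s = r⁶ * U * g
    lem : ∀ s → s * 3072 + s * 192 + (48 * s + 2 * s) ≡ s * 3314
    lem = solve-∀
    slopes : K * (2 * g + 1) ≤ s * 192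
    slopes = ≤-trans (*-mono-≤ (≤-reflexive K≡) (+-monoʳ-≤ (2 * g) 1≤g)) (≤-reflexive (lem′ (r⁶ * U) g))
      where
      lem′ : ∀ p g → 64 * p * (2 * g + g) ≡ p * g * 192
      lem′ = solve-∀
    range : R ≤ 48 * s
    range = ≤-trans (≤-reflexive R≡) (*-monoʳ-≤ 48 (absorb (g * U) r⁶ 1≤r⁶ (lem′ r⁶ U g)))
      where
      lem′ : ∀ p U g → p * U * g ≡ g * U * p
      lem′ = solve-∀
    shift : 2 * g ≤ 2 * s
    shift = *-monoʳ-≤ 2 (absorb g (r⁶ * U) (1≤r⁶ ⊛ 1≤U) (*-comm (r⁶ * U) g))

  hangs≤ : 2 * K * Hmax ≤ vol * 424192
  hangs≤ = ≤-trans (*-mono-≤ (*-monoʳ-≤ 2 (≤-reflexive K≡)) Hmax≤) (≤-reflexive (lem r⁶ U g))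
    where
    lem : ∀ p U g → 2 * (64 * (p * U)) * (p * U * g * 3314) ≡ g * (U * U) * (p * p) * 424192
    lem = solve-∀

  size≤ : size ≤ vol * 426500
  size≤ = begin
    size
      ≤⟨ +-mono-≤ (*-monoʳ-≤ 2 (s≤s K≤)) (+-mono-≤ (*-monoʳ-≤ 2 K≤) (+-mono-≤ nodes≤ (+-mono-≤ mids≤ (+-mono-≤ hangs≤ links≤)))) ⟩
    2 * suc (64 * vol) + (2 * (64 * vol) + (128 * vol + (128 * vol + (vol * 424192 + vol * 1536))))
      ≡⟨ lem₁ vol ⟩
    1 + (1 + vol * 426240)
      ≤⟨ +-mono-≤ 1≤vol (+-monoˡ-≤ (vol * 426240) 1≤vol) ⟩
    vol + (vol + vol * 426240)
      -- The constants add up to 426242; the extra 258 rounds them to 426500.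
      ≤⟨ m≤m+n _ (vol * 258) ⟩
    vol + (vol + vol * 426240) + vol * 258
      ≡⟨ lem₂ vol ⟩
    vol * 426500 ∎
    where
    open ≤-Reasoning
    1≤vol : 1 ≤ vol
    1≤vol = (1≤g ⊛ 1≤U ⊛ 1≤U) ⊛ 1≤r⁶ ⊛ 1≤r⁶
    lem₁ : ∀ vol → 2 * suc (64 * vol) + (2 * (64 * vol) + (128 * vol + (128 * vol + (vol * 424192 + vol * 1536)))) ≡ 1 + (1 + vol * 426240)
    lem₁ = solve-∀
    lem₂ : ∀ vol → vol + (vol + vol * 426240) + vol * 258 ≡ vol * 426500
    lem₂ = solve-∀

*-^ : ∀ a b n → (a * b) ^ n ≡ a ^ n * b ^ n
*-^ a b zero    = refl
*-^ a b (suc n) = trans (cong (a * b *_) (*-^ a b n)) (lem a b (a ^ n) (b ^ n))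
  where
  lem : ∀ a b s t → a * b * (s * t) ≡ a * s * (b * t)
  lem = solve-∀

-- As `suc g` is at most `2 * g`, `n` is at most `(2 * g) ^ B`. After raising to the power `suc B`,
-- the two exponents can be exchanged, and `g ^ suc B` is bounded by `E`.
superlinear : ∀ B {n g E} → 1 ≤ g → n < suc g ^ B → g ^ suc B ≤ E →
  1 ^ B * n ^ (B + 1) ≤ (2 ^ suc B * E) ^ B
superlinear B {n} {g} {E} 1≤g n< g≤E = begin
  1 ^ B * n ^ (B + 1)          ≡⟨ cong (_* n ^ (B + 1)) (^-zeroˡ B) ⟩
  1 * n ^ (B + 1)              ≡⟨ *-identityˡ (n ^ (B + 1)) ⟩
  n ^ (B + 1)                  ≡⟨ cong (n ^_) (+-comm B 1) ⟩
  n ^ suc B                    ≤⟨ ^-monoˡ-≤ (suc B) (≤-trans (<⇒≤ n<) (^-monoˡ-≤ B (+-mono-≤ 1≤g (m≤m+n g 0)))) ⟩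
  ((2 * g) ^ B) ^ suc B        ≡⟨ ^-*-assoc (2 * g) B (suc B) ⟩
  (2 * g) ^ (B * suc B)        ≡⟨ cong ((2 * g) ^_) (*-comm B (suc B)) ⟩
  (2 * g) ^ (suc B * B)        ≡⟨ ^-*-assoc (2 * g) (suc B) B ⟨
  ((2 * g) ^ suc B) ^ B        ≡⟨ cong (_^ B) (*-^ 2 g (suc B)) ⟩
  (2 ^ suc B * g ^ suc B) ^ B  ≤⟨ ^-monoˡ-≤ B (*-monoʳ-≤ (2 ^ suc B) g≤E) ⟩
  (2 ^ suc B * E) ^ B          ∎
  where open ≤-Reasoning

root-bound : ∀ B {β n g} → β ^ B ≤ n → n < suc g ^ B → β ≤ g
root-bound B {β} {n} {g} β≤ n< = ≮⇒≥ λ g<β → <⇒≱ n< (≤-trans (^-monoˡ-≤ B g<β) β≤)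

-- Abstract, so that powers with large numeral exponents do not unfold.
abstract

  pow : ℕ → ℕ → ℕ
  pow = _^_

  pow≡^ : ∀ g e → pow g e ≡ g ^ e
  pow≡^ g e = refl

pow-^ : ∀ g e f → pow g e ^ f ≡ pow g (e * f)
pow-^ g e f = begin
  pow g e ^ f   ≡⟨ cong (_^ f) (pow≡^ g e) ⟩
  (g ^ e) ^ f   ≡⟨ ^-*-assoc g e f ⟩
  g ^ (e * f)   ≡⟨ pow≡^ g (e * f) ⟨
  pow g (e * f) ∎
  where open ≡-Reasoning

pow-+ : ∀ g e f → pow g e * pow g f ≡ pow g (e + f)
pow-+ g e f = begin
  pow g e * pow g f ≡⟨ cong₂ _*_ (pow≡^ g e) (pow≡^ g f) ⟩
  g ^ e * g ^ f     ≡⟨ ^-distribˡ-+-* g e f ⟨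
  g ^ (e + f)       ≡⟨ pow≡^ g (e + f) ⟨
  pow g (e + f)     ∎
  where open ≡-Reasoning

pow>0 : ∀ g .{{_ : NonZero g}} e → 1 ≤ pow g e
pow>0 g e = subst (1 ≤_) (sym (pow≡^ g e)) (m^n>0 g e)

module Scale (g n : ℕ) (c≤g : 426500 ≤ g) (g≤n : pow g 458 ≤ n) where

  k r U : ℕ
  -- `k` exceeds `m = g` by the factor `g³`, which leaves room for a gain. The other exponents are
  -- forced: `7 * 4 = 28` and `4 + 2 * 28 = 60`. Then `vol` has exponent `1 + 120 + 336 = 457`, and
  -- one more factor `g` absorbs the constant 426500.
  k = pow g 4
  r = pow g 28
  U = pow g 60

  1≤g : 1 ≤ g
  1≤g = ≤-trans (m≤m+n 1 426499) c≤g

  instance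
    nzg : NonZero g
    nzg = >-nonZero 1≤g
    nzU : NonZero U
    nzU = >-nonZero (pow>0 g 60)
    nzr : NonZero r
    nzr = >-nonZero (pow>0 g 28)

  _⊗_ : ∀ {s t e f} → s ≡ pow g e → t ≡ pow g f → s * t ≡ pow g (e + f)
  _⊗_ {e = e} {f} refl refl = pow-+ g e f

  g≡ : g ≡ pow g 1
  g≡ = trans (sym (^-identityʳ g)) (sym (pow≡^ g 1))

  k≡ : k ≡ pow g 4
  k≡ = refl

  r≡ : r ≡ pow g 28
  r≡ = refl

  U≡ : U ≡ pow g 60
  U≡ = refl

  open Size g k r U 1≤g (pow>0 g 4) (pow>0 g 28) (pow-^ g 4 7) (sym (k≡ ⊗ (r≡ ⊗ r≡))) using (D; R; r⁶; vol; size≤)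

  vol≡ : vol ≡ pow g 457
  vol≡ = (g≡ ⊗ (U≡ ⊗ U≡)) ⊗ (r⁶≡ ⊗ r⁶≡)
    where
    r⁶≡ : r⁶ ≡ pow g 168
    r⁶≡ = ((r≡ ⊗ r≡) ⊗ r≡) ⊗ ((r≡ ⊗ r≡) ⊗ r≡)

  size≤n : Construction.size 3 k r U g D R ≤ n
  size≤n = begin
    Construction.size 3 k r U g D R ≤⟨ size≤ ⟩
    vol * 426500                      ≤⟨ *-monoʳ-≤ vol c≤g ⟩
    vol * g                           ≡⟨ vol≡ ⊗ g≡ ⟩
    pow g 458                       ≤⟨ g≤n ⟩
    n                               ∎
    where open ≤-Reasoning

  2≤g : 2 ≤ g
  2≤g = ≤-trans (m≤m+n 2 426498) c≤g

  g³≤ : pow g 3 ≤ k ∸ g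
  g³≤ = m+n≤o⇒m≤o∸n (pow g 3) (begin
    pow g 3 + g           ≤⟨ +-monoʳ-≤ (pow g 3) (≤-trans (m≤m*n g (pow g 2) {{>-nonZero (pow>0 g 2)}}) (≤-reflexive (g≡ ⊗ refl {x = pow g 2}))) ⟩
    pow g 3 + pow g 3     ≡⟨ cong (pow g 3 +_) (+-identityʳ (pow g 3)) ⟨
    2 * pow g 3           ≤⟨ *-monoˡ-≤ (pow g 3) 2≤g ⟩
    g * pow g 3           ≡⟨ g≡ ⊗ refl {x = pow g 3} ⟩
    pow g 4               ∎)
    where open ≤-Reasoning

  edges≥ : pow g 459 ≤ U * (U * (r ^ 3 * (r ^ 3 * (r ^ 3 * r ^ 3)))) * (k ∸ g)
  edges≥ = begin
    pow g 459
      -- The exponents are 120 from the copies, 336 from the four vectors and 3 from the layers: one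
      -- more than the 458 of the vertex count.
      ≡⟨ (U≡ ⊗ (U≡ ⊗ (r³≡ ⊗ (r³≡ ⊗ (r³≡ ⊗ r³≡))))) ⊗ refl {x = pow g 3} ⟨
    U * (U * (r ^ 3 * (r ^ 3 * (r ^ 3 * r ^ 3)))) * pow g 3
      ≤⟨ *-monoʳ-≤ (U * (U * (r ^ 3 * (r ^ 3 * (r ^ 3 * r ^ 3))))) g³≤ ⟩
    U * (U * (r ^ 3 * (r ^ 3 * (r ^ 3 * r ^ 3)))) * (k ∸ g) ∎
    where
    open ≤-Reasoning
    r³≡ : r ^ 3 ≡ pow g 84
    r³≡ = pow-^ g 28 3

  2m≤D : 2 * g ≤ D
  2m≤D = ≤-trans (*-monoˡ-≤ g {2} {6} (s≤s (s≤s z≤n))) (m≤m*n (6 * g) (r * r) {{m*n≢0 r r}})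
  square≤D : 2 * g * (3 * (r * r)) ≤ D
  square≤D = ≤-reflexive (lem g (r * r))
    where
    lem : ∀ g s → 2 * g * (3 * s) ≡ 6 * g * s
    lem = solve-∀

  open Finite 3 k r U g D R (pow>0 g 4) (pow>0 g 28) 1≤g
    2m≤D square≤D ≤-refl n size≤n public

-- B is a variable, so that the powers with exponent B do not unfold.
lower-bound : ∀ B → B ≡ 458 →
    Σ ℕ λ e₁ → Σ ℕ λ e₂ → Σ ℕ λ d₁ → Σ ℕ λ d₂ → Σ ℕ λ c₁ → Σ ℕ λ c₂ → Σ ℕ λ N →
      (0 < e₁ × 0 < e₂ × 0 < d₁ × 0 < d₂ × 0 < c₁ × 0 < c₂) ×
      ((n : ℕ) → N ≤ n →
        Σ (Graph n) λ G → Σ (Fin n) λ s → Σ (Fin n) λ t →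
          (β : ℕ) → β ^ d₂ ≤ n ^ d₁ →
          (H : Graph n) → H ⊆G G → FTPreserver2 G H β s t →
          c₁ ^ e₂ * n ^ (e₂ + e₁) ≤ (c₂ * edgeCount H) ^ e₂)
-- Both exponents of the theorem are `1 / B`. The factor `2 ^ suc B` pays for rounding the root of
-- `n` down to `g`, and the threshold `426500 ^ B` ensures that `g` is at least 426500.
lower-bound B B≡ = 1 , B , 1 , B , 1 , 2 ^ suc B , 426500 ^ B ,
  (s≤s z≤n , 1≤B , s≤s z≤n , 1≤B , s≤s z≤n , m^n>0 2 (suc B)) ,
  λ n N≤n → build n (integer-root B 426500 n 1≤B N≤n)
  where
  1≤B : 1 ≤ B
  1≤B = subst (1 ≤_) (sym B≡) (s≤s z≤n)
  build : ∀ n → (∃ λ g → 426500 ≤ g × g ^ B ≤ n × n < suc g ^ B) →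
    Σ (Graph n) λ G → Σ (Fin n) λ s → Σ (Fin n) λ t →
      (β : ℕ) → β ^ B ≤ n ^ 1 → (H : Graph n) → H ⊆G G → FTPreserver2 G H β s t →
      1 ^ B * n ^ (B + 1) ≤ (2 ^ suc B * edgeCount H) ^ B
  build n (g , c≤g , g≤n , n<) = graph , origin , destination , λ β β≤ H H⊆G preserver →
    superlinear B 1≤g n< (≤-trans (≤-reflexive (trans (sym (pow≡^ g (suc B))) (cong (λ e → pow g (suc e)) B≡)))
      (≤-trans edges≥ (Preserver.many-edges β (β<2g β β≤) H H⊆G preserver)))
    where
    open Scale g n c≤g (subst (λ e → pow g e ≤ n) B≡ (subst (_≤ n) (sym (pow≡^ g B)) g≤n))
    β<2g : ∀ β → β ^ B ≤ n ^ 1 → β < 2 * g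
    β<2g β β≤ = ≤-trans (s≤s (root-bound B (≤-trans β≤ (≤-reflexive (^-identityʳ n))) n<)) (+-mono-≤ 1≤g (m≤m+n g 0))

theorem5 :
    Σ ℕ λ e₁ → Σ ℕ λ e₂ → Σ ℕ λ d₁ → Σ ℕ λ d₂ → Σ ℕ λ c₁ → Σ ℕ λ c₂ → Σ ℕ λ N →
      (0 < e₁ × 0 < e₂ × 0 < d₁ × 0 < d₂ × 0 < c₁ × 0 < c₂) ×
      ((n : ℕ) → N ≤ n →
        Σ (Graph n) λ G → Σ (Fin n) λ s → Σ (Fin n) λ t →
          (β : ℕ) → β ^ d₂ ≤ n ^ d₁ →
          (H : Graph n) → H ⊆G G → FTPreserver2 G H β s t →
          c₁ ^ e₂ * n ^ (e₂ + e₁) ≤ (c₂ * edgeCount H) ^ e₂)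
theorem5 = lower-bound 458 refl
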